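{- For any $A,B,B',C,C'\in\widehat{\mathbb{F}_q}$ and any $x,y\in\mathbb{F}_q$, the following three identities hold: $$F_{2}(A;B,B';C,C';x,y)=F_{2}(A;B',B;C',C;y,x),$$ $$F_{2}(A;B,B';C,C';x,1)=B'C'(-1)\;{}_{3}F_2\left(\begin{matrix}A,B,A\overline{C'}\\ C,AB'\overline{C'}\end{matrix}\bigg|\,x\right),$$ $$F_{2}(A;B,B';C,C';1,y)=BC(-1)\;{}_{3}F_2\left(\begin{matrix}A,B',A\overline{C}\\ C',AB\overline{C}\end{matrix}\bigg|\,y\right).$$
   Context: Let $q$ be a power of a prime, $\mathbb{F}_q$ the field with $q$ elements, and $\widehat{\mathbb{F}_q}$ the group of (complex-valued) multiplicative characters of $\mathbb{F}_q^*$. Every character $\chi$, including the trivial character $\varepsilon$, is extended to $\mathbb{F}_q$ by $\chi(0)=0$. $\overline{\chi}$ denotes the inverse of $\chi$. Products of characters are evaluated pointwise, e.g. $BC(-1)=B(-1)C(-1)$. Jacobi sum: $J(\chi,\lambda)=\sum_{u\in\mathbb{F}_q}\chi(u)\lambda(1-u)$. Binomial coefficient of characters: $\binom{A}{B}=B(-1)J(A,\overline{B})$. Finite field ${}_3F_2$: for $A_0,A_1,A_2,B_1,B_2\in\widehat{\mathbb{F}_q}$ and $x\in\mathbb{F}_q$, $${}_{3}F_2\left(\begin{matrix}A_0,A_1,A_2\\ B_1,B_2\end{matrix}\bigg|\,x\right)=\frac{1}{q-1}\sum_{\chi}\binom{A_0\chi}{\chi}\binom{A_1\chi}{B_1\chi}\binom{A_2\chi}{B_2\chi}\chi(x),$$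 the sum being over all multiplicative characters $\chi$ of $\mathbb{F}_q$. The finite field Appell series $F_2$ is defined, for $A,B,B',C,C'\in\widehat{\mathbb{F}_q}$ and $x,y\in\mathbb{F}_q$, by $$F_{2}(A;B,B';C,C';x,y)=\varepsilon(xy)\,BB'CC'(-1)\sum_{u,v\in\mathbb{F}_q}B(u)B'(v)\,\overline{B}C(1-u)\,\overline{B'}C'(1-v)\,\overline{A}(1-ux-vy).$$ -}

module Defs where

open import Algebra.Apartness.Bundles using (HeytingField; HeytingCommutativeRing)
import Algebra.Apartness.Properties.HeytingCommutativeRing as HeytingProperties
open import Algebra.Bundles using (AbelianGroup; CommutativeRing)
import Algebra.Definitions as AlgebraDefinitions
import Algebra.Definitions.RawMonoid as RawMonoidDefinitions
open import Algebra.Morphism.Structures using (IsMonoidHomomorphism)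
import Algebra.Properties.CommutativeSemigroup as CommutativeSemigroupProperties
import Algebra.Properties.CommutativeSemiring.Exp as CommutativeExp
import Algebra.Properties.Group as GroupProperties
import Algebra.Properties.Ring as RingProperties
import Algebra.Properties.Semiring.Exp as Exp
import Algebra.Properties.Semiring.Sum as Sum
open import Data.Fin.Base as Fin using (Fin; toℕ; finToFun; funToFin)
import Data.Fin.Properties as Fin
open import Data.List.Base
  using (List; []; _∷_; allFin; concatMap; deduplicate; foldr; length; lookup; replicate)
open import Data.List.Membership.Propositional.Properties using (∈-allFin)
open import Data.List.Relation.Unary.All as All using (All; []; _∷_)
open import Data.List.Relation.Unary.Any as Any using (Any; here; there)
import Data.List.Relation.Unary.Any.Properties as Any
import Data.List.Relation.Unary.Enumerates.Setoid as Enumerates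
import Data.List.Relation.Unary.Enumerates.Setoid.Properties as Enumerates
import Data.List.Relation.Unary.Unique.Setoid as Unique
import Data.List.Relation.Unary.Unique.DecSetoid.Properties as Unique
open import Data.Nat.Base as ℕ using (ℕ; zero; suc; NonZero; _∸_; _!)
import Data.Nat.Divisibility as ℕ
import Data.Nat.Properties as ℕ
open import Data.Product.Base using (∃; _×_; _,_; proj₁; proj₂)
open import Data.Sum.Base using (_⊎_; inj₁; inj₂)
open import Function.Base using (_∘_)
open import Function.Bundles using (Inverse)
open import Level using (_⊔_) renaming (suc to lsuc)
open import Relation.Binary.Bundles using (DecSetoid; Setoid)
open import Relation.Binary.PropositionalEquality.Core as ≡ using (_≡_)
import Relation.Binary.PropositionalEquality.Properties as ≡
import Relation.Binary.Reasoning.Setoid as ≈-Reasoning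
open import Relation.Nullary.Decidable.Core using (Dec; yes; no; map′; _×-dec_)
open import Relation.Nullary.Negation.Core using (¬_; contradiction)

-- monic R (a₀ ∷ … ∷ aₙ₋₁ ∷ []) z = a₀ + a₁ z + … + aₙ₋₁ zⁿ⁻¹ + zⁿ
monic : ∀ {c ℓ} (R : CommutativeRing c ℓ) → let open CommutativeRing R in
        List Carrier → Carrier → Carrier
monic R []       z = CommutativeRing.1# R
monic R (a ∷ as) z = a + z * monic R as z
  where open CommutativeRing R

-- Algebraically closed fields of characteristic zero.  They stand in for ℂ
-- as the field of values of the characters.  Equality is not assumed to be
-- decidable, so that constructive models of ℂ are included.
record AlgClosedField₀ c ℓ₁ ℓ₂ : Set (lsuc (c ⊔ ℓ₁ ⊔ ℓ₂)) where
  field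
    heytingField : HeytingField c ℓ₁ ℓ₂

  open HeytingField heytingField public

  commutativeRing : CommutativeRing c ℓ₁
  commutativeRing = HeytingCommutativeRing.commutativeRing heytingCommutativeRing

  open CommutativeRing commutativeRing public
    using (ring; semiring; commutativeSemiring; +-rawMonoid; *-rawMonoid; *-commutativeSemigroup)
  open RawMonoidDefinitions +-rawMonoid public using () renaming (_×_ to _·_)

  field
    char-0 : ∀ n → .{{NonZero n}} → (n · 1#) # 0#
    root   : ∀ a as → ∃ λ z → monic commutativeRing (a ∷ as) z ≈ 0#

  1/_ : ∀ n → .{{NonZero n}} → Carrier
  1/ n = proj₁ (#⇒invertible (char-0 n))

  1/-inverse : ∀ n → .{{_ : NonZero n}} → (n · 1#) * 1/ n ≈ 1#
  1/-inverse n = trans (*-congʳ (sym (HeytingProperties.x-0≈x heytingCommutativeRing _)))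
    (proj₂ (proj₂ (#⇒invertible (char-0 n))))

record FiniteField (q : ℕ) c ℓ : Set (lsuc (c ⊔ ℓ)) where
  field
    commutativeRing : CommutativeRing c ℓ

  open CommutativeRing commutativeRing public
  open AlgebraDefinitions _≈_ using (Invertible)

  field
    1≉0           : ¬ (1# ≈ 0#)
    ≉0⇒invertible : ∀ {x} → ¬ (x ≈ 0#) → Invertible 1# _*_ x
    enumeration   : Inverse (≡.setoid (Fin q)) setoid

  open Inverse enumeration public using ()
    renaming (to to element; from to index; from-cong to index-cong; strictlyInverseˡ to element-index)

  infix 4 _≟_

  _≟_ : ∀ x y → Dec (x ≈ y)
  x ≟ y = map′
    (λ eq → trans (sym (element-index x)) (trans (reflexive (≡.cong element eq)) (element-index y)))
    index-cong
    (index x Fin.≟ index y)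

  inv : Carrier → Carrier
  inv x with x ≟ 0#
  ... | yes _  = 0#
  ... | no x≉0 = proj₁ (≉0⇒invertible x≉0)

  instance
    q∸1-nonZero : NonZero (q ∸ 1)
    q∸1-nonZero = helper q index element element-index
      where
      helper : ∀ n (i : Carrier → Fin n) (e : Fin n → Carrier) → (∀ x → e (i x) ≈ x) → NonZero (n ∸ 1)
      helper zero          i _ _   with () ← i 0#
      helper (suc (suc _)) _ _ _   = _
      helper (suc zero)    i e e∘i with i 1# | i 0# | e∘i 1# | e∘i 0#
      ... | Fin.zero | Fin.zero | e≈1 | e≈0 = contradiction (trans (sym e≈1) e≈0) 1≉0

module _ {q c ℓ} (F : FiniteField q c ℓ) where
  open FiniteField F
  open Exp semiring using (_^_; ^-homo-*; ^-congʳ; ^-assocʳ)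
  open ≈-Reasoning setoid

  inv-0 : ∀ {x} → x ≈ 0# → inv x ≈ 0#
  inv-0 {x} x≈0 with x ≟ 0#
  ... | yes _  = refl
  ... | no x≉0 = contradiction x≈0 x≉0

  inv-inverseʳ : ∀ {x} → ¬ (x ≈ 0#) → x * inv x ≈ 1#
  inv-inverseʳ {x} x≉0 with x ≟ 0#
  ... | yes x≈0 = contradiction x≈0 x≉0
  ... | no x≉0′ = proj₂ (proj₂ (≉0⇒invertible x≉0′))

  *-cancelˡ-≉0 : ∀ {x y z} → ¬ (x ≈ 0#) → x * y ≈ x * z → y ≈ z
  *-cancelˡ-≉0 {x} {y} {z} x≉0 xy≈xz = begin
    y                ≈⟨ lemma y ⟨
    inv x * (x * y)  ≈⟨ *-congˡ xy≈xz ⟩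
    inv x * (x * z)  ≈⟨ lemma z ⟩
    z                ∎
    where
    lemma : ∀ w → inv x * (x * w) ≈ w
    lemma w = begin
      inv x * (x * w)  ≈⟨ *-assoc (inv x) x w ⟨
      inv x * x * w    ≈⟨ *-congʳ (trans (*-comm (inv x) x) (inv-inverseʳ x≉0)) ⟩
      1# * w           ≈⟨ *-identityˡ w ⟩
      w                ∎

  *-≉0 : ∀ {x y} → ¬ (x ≈ 0#) → ¬ (y ≈ 0#) → ¬ (x * y ≈ 0#)
  *-≉0 {x} x≉0 y≉0 xy≈0 = y≉0 (*-cancelˡ-≉0 x≉0 (trans xy≈0 (sym (zeroʳ x))))

  inv-unique : ∀ {x y} → ¬ (x ≈ 0#) → x * y ≈ 1# → inv x ≈ y
  inv-unique x≉0 xy≈1 = *-cancelˡ-≉0 x≉0 (trans (inv-inverseʳ x≉0) (sym xy≈1))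

  inv-cong : ∀ {x y} → x ≈ y → inv x ≈ inv y
  inv-cong {x} {y} x≈y = helper (y ≟ 0#)
    where
    helper : Dec (y ≈ 0#) → inv x ≈ inv y
    helper (yes y≈0) = trans (inv-0 (trans x≈y y≈0)) (sym (inv-0 y≈0))
    helper (no y≉0)  = inv-unique (y≉0 ∘ trans (sym x≈y)) (trans (*-congʳ x≈y) (inv-inverseʳ y≉0))

  inv-1 : inv 1# ≈ 1#
  inv-1 = inv-unique 1≉0 (*-identityˡ 1#)

  inv-* : ∀ x y → inv (x * y) ≈ inv x * inv y
  inv-* x y = helper (x ≟ 0#) (y ≟ 0#)
    where
    open CommutativeSemigroupProperties *-commutativeSemigroup using (interchange)

    helper : Dec (x ≈ 0#) → Dec (y ≈ 0#) → inv (x * y) ≈ inv x * inv y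
    helper (yes x≈0) _ = trans (inv-0 (trans (*-congʳ x≈0) (zeroˡ y)))
      (sym (trans (*-congʳ (inv-0 x≈0)) (zeroˡ _)))
    helper (no _) (yes y≈0) = trans (inv-0 (trans (*-congˡ y≈0) (zeroʳ x)))
      (sym (trans (*-congˡ (inv-0 y≈0)) (zeroʳ _)))
    helper (no x≉0) (no y≉0) = inv-unique (*-≉0 x≉0 y≉0) (begin
      x * y * (inv x * inv y)    ≈⟨ interchange x y (inv x) (inv y) ⟩
      x * inv x * (y * inv y)    ≈⟨ *-cong (inv-inverseʳ x≉0) (inv-inverseʳ y≉0) ⟩
      1# * 1#                    ≈⟨ *-identityˡ 1# ⟩
      1#                         ∎)

  ^-≉0 : ∀ {x} → ¬ (x ≈ 0#) → ∀ n → ¬ (x ^ n ≈ 0#)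
  ^-≉0 x≉0 zero    = 1≉0
  ^-≉0 x≉0 (suc n) = *-≉0 x≉0 (^-≉0 x≉0 n)

  1^n≈1 : ∀ n → 1# ^ n ≈ 1#
  1^n≈1 zero    = refl
  1^n≈1 (suc n) = trans (*-identityˡ _) (1^n≈1 n)

  -- A (crude) exponent of the multiplicative group.
  ^-q!≈1 : ∀ {x} → ¬ (x ≈ 0#) → x ^ (q !) ≈ 1#
  ^-q!≈1 {x} x≉0 with Fin.pigeonhole (ℕ.n<1+n q) (λ i → index (x ^ toℕ i))
  ... | i , j , i<j , eq with ℕ.m≤n⇒∃[o]m+o≡n i<j
  ... | d , i+d≡j with k∣q!
    where
    k≤q : suc d ℕ.≤ q
    k≤q = ℕ.≤-pred (ℕ.≤-trans
      (ℕ.s≤s (≡.subst (suc d ℕ.≤_) i+d≡j (ℕ.s≤s (ℕ.m≤n+m d (toℕ i))))) (Fin.toℕ<n j))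
    k∣q! : suc d ℕ.∣ q !
    k∣q! = ℕ.∣-trans (ℕ.m∣m*n (d !)) (ℕ.m≤n⇒m!∣n! k≤q)
  ... | ℕ.divides m q!≡mk = begin
    x ^ (q !)          ≈⟨ ^-congʳ x (≡.trans q!≡mk (ℕ.*-comm m (suc d))) ⟩
    x ^ (suc d ℕ.* m)  ≈⟨ ^-assocʳ x (suc d) m ⟨
    (x ^ suc d) ^ m    ≈⟨ Exp.^-congˡ semiring m x^k≈1 ⟩
    1# ^ m             ≈⟨ 1^n≈1 m ⟩
    1#                 ∎
    where
    xⁱ≈xʲ : x ^ toℕ i ≈ x ^ toℕ j
    xⁱ≈xʲ = trans (sym (element-index _)) (trans (reflexive (≡.cong element eq)) (element-index _))
    x^k≈1 : x ^ suc d ≈ 1#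
    x^k≈1 = *-cancelˡ-≉0 (^-≉0 x≉0 (toℕ i)) (begin
      x ^ toℕ i * x ^ suc d  ≈⟨ ^-homo-* x (toℕ i) (suc d) ⟨
      x ^ (toℕ i ℕ.+ suc d)  ≈⟨ ^-congʳ x (≡.trans (ℕ.+-suc (toℕ i) d) i+d≡j) ⟩
      x ^ toℕ j              ≈⟨ xⁱ≈xʲ ⟨
      x ^ toℕ i              ≈⟨ *-identityʳ _ ⟨
      x ^ toℕ i * 1#         ∎)

module RootsOfUnity {c ℓ₁ ℓ₂} (K : AlgClosedField₀ c ℓ₁ ℓ₂) where
  open AlgClosedField₀ K
  open HeytingProperties heytingCommutativeRing using (x-0≈x; 1#0)
  open Exp semiring using (_^_; ^-congˡ; ^-congʳ; ^-assocʳ)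
  open CommutativeExp commutativeSemiring using (^-distrib-*)
  open RingProperties ring using (x[y-z]≈xy-xz; [y-z]x≈yx-zx)
  open GroupProperties (CommutativeRing.+-group commutativeRing)
    using (∙-cancelʳ; x∙y⁻¹≈ε⇒x≈y)
  open ≈-Reasoning setoid

  private
    P : List Carrier → Carrier → Carrier
    P = monic commutativeRing

  #0⇒*-cancelʳ : ∀ {x y z} → z # 0# → x * z ≈ y * z → x ≈ y
  #0⇒*-cancelʳ {x} {y} {z} z#0 xz≈yz = begin
    x            ≈⟨ lemma x ⟨
    x * z * z⁻¹  ≈⟨ *-congʳ xz≈yz ⟩
    y * z * z⁻¹  ≈⟨ lemma y ⟩
    y            ∎
    where
    z⁻¹ : Carrier
    z⁻¹ = proj₁ (#⇒invertible z#0)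
    lemma : ∀ w → w * z * z⁻¹ ≈ w
    lemma w = begin
      w * z * z⁻¹           ≈⟨ *-assoc w z z⁻¹ ⟩
      w * (z * z⁻¹)         ≈⟨ *-congˡ (*-congʳ (x-0≈x z)) ⟨
      w * ((z - 0#) * z⁻¹)  ≈⟨ *-congˡ (proj₂ (proj₂ (#⇒invertible z#0))) ⟩
      w * 1#                ≈⟨ *-identityʳ w ⟩
      w                     ∎

  1^n≈1ᴷ : ∀ n → 1# ^ n ≈ 1#
  1^n≈1ᴷ zero    = refl
  1^n≈1ᴷ (suc n) = trans (*-identityˡ _) (1^n≈1ᴷ n)

  -- Equality of roots of unity is decidable: if z ^ n ≈ 1# then
  -- (z - 1#) * (1# + z + … + z ^ (n ∸ 1)) ≈ 0#, and the second factor is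
  -- n · 1# # 0# when z ≈ 1#.

  geometric : Carrier → ℕ → Carrier
  geometric z zero    = 0#
  geometric z (suc n) = 1# + z * geometric z n

  geometric-telescope : ∀ z n → z * geometric z n + 1# ≈ geometric z n + z ^ n
  geometric-telescope z zero    = +-congʳ (zeroʳ z)
  geometric-telescope z (suc n) = begin
    z * (1# + z * G) + 1#     ≈⟨ +-congʳ (*-congˡ (+-comm 1# (z * G))) ⟩
    z * (z * G + 1#) + 1#     ≈⟨ +-congʳ (*-congˡ (geometric-telescope z n)) ⟩
    z * (G + z ^ n) + 1#      ≈⟨ +-congʳ (distribˡ z G (z ^ n)) ⟩
    z * G + z * z ^ n + 1#    ≈⟨ +-comm _ 1# ⟩
    1# + (z * G + z * z ^ n)  ≈⟨ +-assoc 1# (z * G) (z * z ^ n) ⟨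
    1# + z * G + z * z ^ n    ∎
    where
    G : Carrier
    G = geometric z n

  geometric-1 : ∀ {z} → z ≈ 1# → ∀ n → geometric z n ≈ n · 1#
  geometric-1 z≈1 zero    = refl
  geometric-1 z≈1 (suc n) = +-congˡ (trans (*-cong z≈1 (geometric-1 z≈1 n)) (*-identityˡ _))

  ≈1? : ∀ {z n} → .{{NonZero n}} → z ^ n ≈ 1# → Dec (z ≈ 1#)
  ≈1? {z} {n} zⁿ≈1 with #-cotrans (char-0 n) (geometric z n)
  ... | inj₁ n#G = no λ z≈1 → #-irrefl (sym (geometric-1 z≈1 n)) n#G
  ... | inj₂ G#0 = yes (#0⇒*-cancelʳ G#0 (trans
    (∙-cancelʳ 1# _ _ (trans (geometric-telescope z n) (+-congˡ zⁿ≈1)))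
    (sym (*-identityˡ _))))

  unity-≟ : ∀ m {z w} → z ^ suc m ≈ 1# → w ^ suc m ≈ 1# → Dec (z ≈ w)
  unity-≟ m {z} {w} z^n≈1 w^n≈1 = map′ to from (≈1? {z * w ^ m} {suc m} (begin
    (z * w ^ m) ^ suc m        ≈⟨ ^-distrib-* z (w ^ m) (suc m) ⟩
    z ^ suc m * (w ^ m) ^ suc m  ≈⟨ *-cong z^n≈1 (^-assocʳ w m (suc m)) ⟩
    1# * w ^ (m ℕ.* suc m)     ≈⟨ *-identityˡ _ ⟩
    w ^ (m ℕ.* suc m)          ≈⟨ ^-congʳ w (ℕ.*-comm m (suc m)) ⟩
    w ^ (suc m ℕ.* m)          ≈⟨ ^-assocʳ w (suc m) m ⟨
    (w ^ suc m) ^ m            ≈⟨ ^-congˡ m w^n≈1 ⟩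
    1# ^ m                     ≈⟨ 1^n≈1ᴷ m ⟩
    1#                         ∎))
    where
    to : z * w ^ m ≈ 1# → z ≈ w
    to eq = begin
      z                ≈⟨ *-identityʳ z ⟨
      z * 1#           ≈⟨ *-congˡ w^n≈1 ⟨
      z * (w * w ^ m)  ≈⟨ *-congˡ (*-comm w (w ^ m)) ⟩
      z * (w ^ m * w)  ≈⟨ *-assoc z (w ^ m) w ⟨
      z * w ^ m * w    ≈⟨ *-congʳ eq ⟩
      1# * w           ≈⟨ *-identityˡ w ⟩
      w                ∎
    from : z ≈ w → z * w ^ m ≈ 1#
    from z≈w = trans (*-congʳ z≈w) w^n≈1

  deflate : List Carrier → Carrier → List Carrier
  deflate []            r = []
  deflate (a ∷ [])      r = []
  deflate (a ∷ b ∷ as)  r = P (b ∷ as) r ∷ deflate (b ∷ as) r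

  length-deflate : ∀ a as r → length (deflate (a ∷ as) r) ≡ length as
  length-deflate a []       r = ≡.refl
  length-deflate a (b ∷ as) r = ≡.cong suc (length-deflate b as r)

  P-deflate : ∀ a as r z → P (a ∷ as) z ≈ (z - r) * P (deflate (a ∷ as) r) z + P (a ∷ as) r
  P-deflate a as r z = begin
    a + z * p                      ≈⟨ +-comm a (z * p) ⟩
    z * p + a                      ≈⟨ +-congʳ (lemma as) ⟩
    (z - r) * Q + r * P as r + a   ≈⟨ +-assoc _ _ _ ⟩
    (z - r) * Q + (r * P as r + a) ≈⟨ +-congˡ (+-comm _ a) ⟩
    (z - r) * Q + (a + r * P as r) ∎
    where
    p Q : Carrier
    p = P as z
    Q = P (deflate (a ∷ as) r) z
    split : ∀ u → z * u ≈ (z - r) * u + r * u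
    split u = begin
      z * u                ≈⟨ *-congʳ (+-identityʳ z) ⟨
      (z + 0#) * u         ≈⟨ *-congʳ (+-congˡ (-‿inverseˡ r)) ⟨
      (z + (- r + r)) * u  ≈⟨ *-congʳ (+-assoc z (- r) r) ⟨
      (z - r + r) * u      ≈⟨ distribʳ u (z - r) r ⟩
      (z - r) * u + r * u  ∎
    lemma : ∀ as → z * P as z ≈ (z - r) * P (deflate (a ∷ as) r) z + r * P as r
    lemma []       = split 1#
    lemma (b ∷ as) = begin
      z * P (b ∷ as) z             ≈⟨ *-congˡ (P-deflate b as r z) ⟩
      z * (d * D + U)              ≈⟨ distribˡ z (d * D) U ⟩
      z * (d * D) + z * U          ≈⟨ +-cong (x∙yz≈y∙xz z d D) (split U) ⟩
      d * (z * D) + (d * U + r * U)  ≈⟨ +-assoc _ _ _ ⟨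
      d * (z * D) + d * U + r * U  ≈⟨ +-congʳ (distribˡ d (z * D) U) ⟨
      d * (z * D + U) + r * U      ≈⟨ +-congʳ (*-congˡ (+-comm (z * D) U)) ⟩
      d * (U + z * D) + r * U      ∎
      where
      open CommutativeSemigroupProperties *-commutativeSemigroup using (x∙yz≈y∙xz)
      d U D : Carrier
      d = z - r
      U = P (b ∷ as) r
      D = P (deflate (b ∷ as) r) z

  linearFactors : List Carrier → Carrier → Carrier
  linearFactors rs z = foldr (λ r p → (z - r) * p) 1# rs

  splits : ∀ n as → length as ≡ n → ∃ λ rs → ∀ z → P as z ≈ linearFactors rs z
  splits zero    []       _  = [] , λ _ → refl
  splits (suc n) (a ∷ as) eq with root a as
  ... | r , Pr≈0 with splits n (deflate (a ∷ as) r) (≡.trans (length-deflate a as r) (ℕ.suc-injective eq))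
  ... | rs , P≈ = r ∷ rs , λ z → begin
    P (a ∷ as) z                                          ≈⟨ P-deflate a as r z ⟩
    (z - r) * P (deflate (a ∷ as) r) z + P (a ∷ as) r     ≈⟨ +-cong (*-congˡ (P≈ z)) Pr≈0 ⟩
    (z - r) * linearFactors rs z + 0#                     ≈⟨ +-identityʳ _ ⟩
    (z - r) * linearFactors rs z                          ∎

  linearFactors-root : ∀ {rs z} → Any (z ≈_) rs → linearFactors rs z ≈ 0#
  linearFactors-root {r ∷ rs} {z} (here z≈r) = begin
    (z - r) * linearFactors rs z  ≈⟨ *-congʳ (+-congʳ z≈r) ⟩
    (r - r) * linearFactors rs z  ≈⟨ *-congʳ (-‿inverseʳ r) ⟩
    0# * linearFactors rs z       ≈⟨ zeroˡ _ ⟩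
    0#                            ∎
  linearFactors-root {r ∷ rs} {z} (there z∈rs) =
    trans (*-congˡ (linearFactors-root z∈rs)) (zeroʳ _)

  root-linearFactors : ∀ {rs z} → All (λ r → Dec (z ≈ r)) rs → linearFactors rs z ≈ 0# → Any (z ≈_) rs
  root-linearFactors []               1≈0  = contradiction 1#0 (#-irrefl 1≈0)
  root-linearFactors (yes z≈r ∷ _)    _    = here z≈r
  root-linearFactors {r ∷ rs} {z} (no z≉r ∷ z≟rs) eq =
    there (root-linearFactors z≟rs (proj₁ (tight _ _) λ L#0 →
      z≉r (x∙y⁻¹≈ε⇒x≈y z r (#0⇒*-cancelʳ L#0 (trans eq (sym (zeroˡ _)))))))

  module _ (m : ℕ) where

    private
      P-replicate : ∀ n z → P (replicate n 0#) z ≈ z ^ n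
      P-replicate zero    z = refl
      P-replicate (suc n) z = trans (+-identityˡ _) (*-congˡ (P-replicate n z))

      split-unity : ∃ λ rs → ∀ z → P (- 1# ∷ replicate m 0#) z ≈ linearFactors rs z
      split-unity = splits (suc (length (replicate m 0#))) (- 1# ∷ replicate m 0#) ≡.refl

    unityRoots : List Carrier
    unityRoots = proj₁ split-unity

    private
      unity≈ : ∀ z → z ^ suc m - 1# ≈ linearFactors unityRoots z
      unity≈ z = trans (trans (+-congʳ (*-congˡ {z} (sym (P-replicate m z)))) (+-comm _ _))
        (proj₂ split-unity z)

    unityRoots-sound : ∀ {z} → Any (z ≈_) unityRoots → z ^ suc m ≈ 1#
    unityRoots-sound {z} z∈ = x∙y⁻¹≈ε⇒x≈y _ _ (trans (unity≈ z) (linearFactors-root z∈))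

    unityRoots-complete : ∀ {z} → z ^ suc m ≈ 1# → Any (z ≈_) unityRoots
    unityRoots-complete {z} z^n≈1 = root-linearFactors (All.tabulate λ r∈ →
        unity-≟ m z^n≈1 (unityRoots-sound (Any.map (λ { ≡.refl → refl }) r∈)))
      (trans (sym (unity≈ z)) (trans (+-congʳ z^n≈1) (-‿inverseʳ 1#)))

module Characters {q c₁ ℓ₁ c₂ ℓ₂ ℓ₃}
  (F : FiniteField q c₁ ℓ₁) (K : AlgClosedField₀ c₂ ℓ₂ ℓ₃) where

  private
    module F = FiniteField F
    module K = AlgClosedField₀ K
  open K using (_≈_; _+_; _*_; 0#; 1#)

  -- A homomorphism from the group of nonzero elements, extended by 0 ↦ 0;
  -- the extension is multiplicative on all of F.
  record Character : Set (c₁ ⊔ ℓ₁ ⊔ c₂ ⊔ ℓ₂) where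
    field
      eval                 : F.Carrier → K.Carrier
      isMonoidHomomorphism : IsMonoidHomomorphism F.*-rawMonoid K.*-rawMonoid eval
      eval-0               : eval F.0# ≈ 0#

    open IsMonoidHomomorphism isMonoidHomomorphism public
      renaming (⟦⟧-cong to eval-cong; homo to eval-*; ε-homo to eval-1)
      using ()

  open Character

  infix 9 _⟨_⟩

  _⟨_⟩ : Character → F.Carrier → K.Carrier
  χ ⟨ x ⟩ = eval χ x

  mkCharacter : (f : F.Carrier → K.Carrier) → (∀ {x y} → x F.≈ y → f x ≈ f y) →
                (∀ x y → f (x F.* y) ≈ f x * f y) → f F.1# ≈ 1# → f F.0# ≈ 0# → Character
  mkCharacter f f-cong f-* f-1 f-0 = record
    { eval                 = f
    ; isMonoidHomomorphism = record
      { isMagmaHomomorphism = record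
        { isRelHomomorphism = record { cong = f-cong }
        ; homo              = f-*
        }
      ; ε-homo = f-1
      }
    ; eval-0 = f-0
    }

  eval-≈0 : ∀ χ {x} → x F.≈ F.0# → χ ⟨ x ⟩ ≈ 0#
  eval-≈0 χ x≈0 = K.trans (eval-cong χ x≈0) (eval-0 χ)

  infix 4 _≋_

  _≋_ : Character → Character → Set (c₁ ⊔ ℓ₂)
  χ ≋ ψ = ∀ x → χ ⟨ x ⟩ ≈ ψ ⟨ x ⟩

  private
    ε-eval : ∀ {x} → Dec (x F.≈ F.0#) → K.Carrier
    ε-eval (yes _) = 0#
    ε-eval (no _)  = 1#

    ε-yes : ∀ {x} → x F.≈ F.0# → (d : Dec (x F.≈ F.0#)) → ε-eval d ≈ 0#
    ε-yes x≈0 (yes _)  = K.refl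
    ε-yes x≈0 (no x≉0) = contradiction x≈0 x≉0

    ε-no : ∀ {x} → ¬ (x F.≈ F.0#) → (d : Dec (x F.≈ F.0#)) → ε-eval d ≈ 1#
    ε-no x≉0 (yes x≈0) = contradiction x≈0 x≉0
    ε-no x≉0 (no _)    = K.refl

    ε-cong : ∀ {x y} → x F.≈ y → (d : Dec (x F.≈ F.0#)) (e : Dec (y F.≈ F.0#)) → ε-eval d ≈ ε-eval e
    ε-cong x≈y (yes x≈0) e = K.sym (ε-yes (F.trans (F.sym x≈y) x≈0) e)
    ε-cong x≈y (no x≉0)  e = K.sym (ε-no (x≉0 ∘ F.trans x≈y) e)

    ε-* : ∀ {x y} (d : Dec (x F.≈ F.0#)) (e : Dec (y F.≈ F.0#)) (xy : Dec (x F.* y F.≈ F.0#)) →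
          ε-eval xy ≈ ε-eval d * ε-eval e
    ε-* {x} {y} (yes x≈0) e xy =
      K.trans (ε-yes (F.trans (F.*-congʳ x≈0) (F.zeroˡ y)) xy) (K.sym (K.zeroˡ _))
    ε-* {x} {y} (no _) (yes y≈0) xy =
      K.trans (ε-yes (F.trans (F.*-congˡ y≈0) (F.zeroʳ x)) xy) (K.sym (K.zeroʳ _))
    ε-* (no x≉0) (no y≉0) xy = K.trans (ε-no (*-≉0 F x≉0 y≉0) xy) (K.sym (K.*-identityˡ _))

  ε : Character
  ε = mkCharacter (λ x → ε-eval (x F.≟ F.0#))
    (λ {x} {y} x≈y → ε-cong x≈y (x F.≟ F.0#) (y F.≟ F.0#))
    (λ x y → ε-* (x F.≟ F.0#) (y F.≟ F.0#) (x F.* y F.≟ F.0#))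
    (ε-no F.1≉0 (F.1# F.≟ F.0#))
    (ε-yes F.refl (F.0# F.≟ F.0#))

  ε-≈0 : ∀ {x} → x F.≈ F.0# → ε ⟨ x ⟩ ≈ 0#
  ε-≈0 = eval-≈0 ε

  ε-≉0 : ∀ {x} → ¬ (x F.≈ F.0#) → ε ⟨ x ⟩ ≈ 1#
  ε-≉0 {x} x≉0 = ε-no x≉0 (x F.≟ F.0#)

  infixl 7 _∙_

  _∙_ : Character → Character → Character
  χ ∙ ψ = mkCharacter (λ x → χ ⟨ x ⟩ * ψ ⟨ x ⟩)
    (λ x≈y → K.*-cong (eval-cong χ x≈y) (eval-cong ψ x≈y))
    (λ x y → K.trans (K.*-cong (eval-* χ x y) (eval-* ψ x y)) (interchange _ _ _ _))
    (K.trans (K.*-cong (eval-1 χ) (eval-1 ψ)) (K.*-identityˡ 1#))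
    (K.trans (K.*-congʳ (eval-0 χ)) (K.zeroˡ _))
    where open CommutativeSemigroupProperties K.*-commutativeSemigroup using (interchange)

  infix 8 _⁻¹

  _⁻¹ : Character → Character
  χ ⁻¹ = mkCharacter (λ x → χ ⟨ F.inv x ⟩)
    (λ x≈y → eval-cong χ (inv-cong F x≈y))
    (λ x y → K.trans (eval-cong χ (inv-* F x y)) (eval-* χ _ _))
    (K.trans (eval-cong χ (inv-1 F)) (eval-1 χ))
    (eval-≈0 χ (inv-0 F F.refl))

  private
    by-cases : ∀ χ ψ → (∀ x → ¬ (x F.≈ F.0#) → χ ⟨ x ⟩ ≈ ψ ⟨ x ⟩) → χ ≋ ψ
    by-cases χ ψ eq x with x F.≟ F.0#
    ... | yes x≈0 = K.trans (eval-≈0 χ x≈0) (K.sym (eval-≈0 ψ x≈0))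
    ... | no x≉0  = eq x x≉0

    ∙-comm : ∀ χ ψ → (χ ∙ ψ) ≋ (ψ ∙ χ)
    ∙-comm χ ψ x = K.*-comm _ _

    identityˡ : ∀ χ → (ε ∙ χ) ≋ χ
    identityˡ χ = by-cases (ε ∙ χ) χ λ x x≉0 → K.trans (K.*-congʳ (ε-≉0 x≉0)) (K.*-identityˡ _)

    inverseʳ : ∀ χ → (χ ∙ χ ⁻¹) ≋ ε
    inverseʳ χ = by-cases (χ ∙ χ ⁻¹) ε λ x x≉0 →
      K.trans (K.sym (eval-* χ _ _)) (K.trans (eval-cong χ (inv-inverseʳ F x≉0))
        (K.trans (eval-1 χ) (K.sym (ε-≉0 x≉0))))

  characterGroup : AbelianGroup (c₁ ⊔ ℓ₁ ⊔ c₂ ⊔ ℓ₂) (c₁ ⊔ ℓ₂)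
  characterGroup = record
    { Carrier = Character
    ; _≈_     = _≋_
    ; _∙_     = _∙_
    ; ε       = ε
    ; _⁻¹     = _⁻¹
    ; isAbelianGroup = record
      { isGroup = record
        { isMonoid = record
          { isSemigroup = record
            { isMagma = record
              { isEquivalence = record
                { refl  = λ x → K.refl
                ; sym   = λ eq x → K.sym (eq x)
                ; trans = λ eq₁ eq₂ x → K.trans (eq₁ x) (eq₂ x)
                }
              ; ∙-cong = λ eq₁ eq₂ x → K.*-cong (eq₁ x) (eq₂ x)
              }
            ; assoc = λ χ ψ φ x → K.*-assoc _ _ _
            }
          ; identity = identityˡ , λ χ x → K.trans (∙-comm χ ε x) (identityˡ χ x)
          }
        ; inverse = (λ χ x → K.trans (∙-comm (χ ⁻¹) χ x) (inverseʳ χ x)) , inverseʳ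
        ; ⁻¹-cong = λ eq x → eq (F.inv x)
        }
      ; comm = ∙-comm
      }
    }

  open AbelianGroup characterGroup using () renaming (setoid to characterSetoid)

  -- There are finitely many characters: their nonzero values are roots of
  -- unity, so they occur among the finitely many functions with such values.

  private
    module R = RootsOfUnity K
    open Exp K.semiring using (_^_; ^-congˡ)
    open CommutativeExp K.commutativeSemiring using (^-distrib-*)
    open Exp F.semiring using () renaming (_^_ to _^ᶠ_; ^-congʳ to ^ᶠ-congʳ)

    m : ℕ
    m = ℕ.pred (q !)

    Value : K.Carrier → Set ℓ₂
    Value a = a ≈ 0# ⊎ a ^ suc m ≈ 1#

    root≉0 : ∀ {a b} → a ≈ 0# → b ^ suc m ≈ 1# → ¬ (a ≈ b)
    root≉0 a≈0 b^n≈1 a≈b = K.#-irrefl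
      (K.trans (K.sym b^n≈1) (K.trans (K.*-congʳ (K.trans (K.sym a≈b) a≈0)) (K.zeroˡ _)))
      (HeytingProperties.1#0 K.heytingCommutativeRing)

    value-≟ : ∀ {a b} → Value a → Value b → Dec (a ≈ b)
    value-≟ (inj₁ a≈0)   (inj₁ b≈0)   = yes (K.trans a≈0 (K.sym b≈0))
    value-≟ (inj₁ a≈0)   (inj₂ b^n≈1) = no (root≉0 a≈0 b^n≈1)
    value-≟ (inj₂ a^n≈1) (inj₁ b≈0)   = no (root≉0 b≈0 a^n≈1 ∘ K.sym)
    value-≟ (inj₂ a^n≈1) (inj₂ b^n≈1) = R.unity-≟ m a^n≈1 b^n≈1

    value-* : ∀ {a b} → Value a → Value b → Value (a * b)
    value-* (inj₁ a≈0)   _          = inj₁ (K.trans (K.*-congʳ a≈0) (K.zeroˡ _))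
    value-* (inj₂ _)     (inj₁ b≈0) = inj₁ (K.trans (K.*-congˡ b≈0) (K.zeroʳ _))
    value-* (inj₂ a^n≈1) (inj₂ b^n≈1) = inj₂
      (K.trans (^-distrib-* _ _ (suc m)) (K.trans (K.*-cong a^n≈1 b^n≈1) (K.*-identityˡ 1#)))

    eval-^ : ∀ χ x n → χ ⟨ x ^ᶠ n ⟩ ≈ χ ⟨ x ⟩ ^ n
    eval-^ χ x zero    = eval-1 χ
    eval-^ χ x (suc n) = K.trans (eval-* χ _ _) (K.*-congˡ (eval-^ χ x n))

    eval-value : ∀ χ x → Value (χ ⟨ x ⟩)
    eval-value χ x with x F.≟ F.0#
    ... | yes x≈0 = inj₁ (eval-≈0 χ x≈0)
    ... | no x≉0  = inj₂ (K.trans (K.sym (eval-^ χ x (suc m))) (K.trans (eval-cong χ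
      (F.trans (^ᶠ-congʳ x (ℕ.suc-pred (q !) {{ℕ._!≢0 q}})) (^-q!≈1 F x≉0))) (eval-1 χ)))

    values : List K.Carrier
    values = 0# ∷ R.unityRoots m

    value : Fin (length values) → K.Carrier
    value = lookup values

    value-sound : ∀ i → Value (value i)
    value-sound Fin.zero    = inj₁ K.refl
    value-sound (Fin.suc i) = inj₂ (R.unityRoots-sound m (lookup∈ i))
      where
      lookup∈ : ∀ {xs : List K.Carrier} (i : Fin (length xs)) → Any (lookup xs i ≈_) xs
      lookup∈ {_ ∷ _} Fin.zero    = here K.refl
      lookup∈ {_ ∷ _} (Fin.suc i) = there (lookup∈ i)

    value-complete : ∀ {a} → Value a → ∃ λ i → a ≈ value i
    value-complete (inj₁ a≈0)   = Fin.zero , a≈0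
    value-complete (inj₂ a^n≈1) = let a∈ = R.unityRoots-complete m a^n≈1 in
      Fin.suc (Any.index a∈) , Any.lookup-index a∈

    function : (Fin q → Fin (length values)) → F.Carrier → K.Carrier
    function g x = value (g (F.index x))

    IsCharacter : (Fin q → Fin (length values)) → Set ℓ₂
    IsCharacter g = f F.0# ≈ 0# × f F.1# ≈ 1# ×
      (∀ i j → f (F.element i F.* F.element j) ≈ f (F.element i) * f (F.element j))
      where
      f : F.Carrier → K.Carrier
      f = function g

    isCharacter? : ∀ g → Dec (IsCharacter g)
    isCharacter? g =
      value-≟ (valid F.0#) (inj₁ K.refl) ×-dec
      value-≟ (valid F.1#) (inj₂ (R.1^n≈1ᴷ (suc m))) ×-dec
      Fin.all? λ i → Fin.all? λ j → value-≟
        (valid (F.element i F.* F.element j)) (value-* (valid (F.element i)) (valid (F.element j)))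
      where
      valid : ∀ x → Value (function g x)
      valid x = value-sound (g (F.index x))

    toCharacter : ∀ g → IsCharacter g → Character
    toCharacter g (f-0 , f-1 , f-*) = mkCharacter (function g) f-cong
      (λ x y → K.trans
        (f-cong (F.sym (F.*-cong (F.element-index x) (F.element-index y))))
        (K.trans (f-* (F.index x) (F.index y))
          (K.*-cong (f-cong (F.element-index x)) (f-cong (F.element-index y)))))
      f-1 f-0
      where
      f-cong : ∀ {x y} → x F.≈ y → function g x ≈ function g y
      f-cong x≈y = K.reflexive (≡.cong (value ∘ g) (F.index-cong x≈y))

    candidate : ∀ g → Dec (IsCharacter g) → List Character
    candidate g (yes p) = toCharacter g p ∷ []
    candidate g (no _)  = []

    candidates : List Character
    candidates = concatMap (λ k → candidate (finToFun k) (isCharacter? (finToFun k)))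
      (allFin (length values ℕ.^ q))

    candidates-complete : ∀ χ → Any (χ ≋_) candidates
    candidates-complete χ = Any.concatMap⁺ _
      (Any.map (λ { ≡.refl → found (isCharacter? h) }) (∈-allFin (funToFin g)))
      where
      g : Fin q → Fin (length values)
      g i = proj₁ (value-complete (eval-value χ (F.element i)))
      h : Fin q → Fin (length values)
      h = finToFun (funToFin g)
      χ≈h : ∀ x → χ ⟨ x ⟩ ≈ function h x
      χ≈h x = K.trans (eval-cong χ (F.sym (F.element-index x)))
        (K.trans (proj₂ (value-complete (eval-value χ (F.element (F.index x)))))
          (K.reflexive (≡.cong value (≡.sym (Fin.finToFun-funToFin g (F.index x))))))
      found : (d : Dec (IsCharacter h)) → Any (χ ≋_) (candidate h d)
      found (yes _) = here χ≈h
      found (no ¬p) = contradiction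
        ( K.trans (K.sym (χ≈h _)) (eval-0 χ)
        , K.trans (K.sym (χ≈h _)) (eval-1 χ)
        , λ i j → K.trans (K.sym (χ≈h _)) (K.trans (eval-* χ _ _) (K.*-cong (χ≈h _) (χ≈h _)))
        ) ¬p

  _≋?_ : ∀ χ ψ → Dec (χ ≋ ψ)
  χ ≋? ψ = map′
    (λ eq x → K.trans (eval-cong χ (F.sym (F.element-index x)))
      (K.trans (eq (F.index x)) (eval-cong ψ (F.element-index x))))
    (λ eq i → eq (F.element i))
    (Fin.all? λ i → value-≟ (eval-value χ (F.element i)) (eval-value ψ (F.element i)))

  private
    characterDecSetoid : DecSetoid (c₁ ⊔ ℓ₁ ⊔ c₂ ⊔ ℓ₂) (c₁ ⊔ ℓ₂)
    characterDecSetoid = record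
      { isDecEquivalence = record
        { isEquivalence = Setoid.isEquivalence characterSetoid
        ; _≟_           = _≋?_
        }
      }

  abstract
    characters : List Character
    characters = deduplicate _≋?_ candidates

    characters-complete : Enumerates.IsEnumeration characterSetoid characters
    characters-complete = Enumerates.deduplicate⁺ characterDecSetoid candidates-complete

    characters-unique : Unique.Unique characterSetoid characters
    characters-unique = Unique.deduplicate-! characterDecSetoid candidates

  open Sum K.semiring using (sum)

  ∑-elements : (F.Carrier → K.Carrier) → K.Carrier
  ∑-elements f = sum (λ i → f (F.element i))

  ∑-characters : (Character → K.Carrier) → K.Carrier
  ∑-characters f = foldr (λ χ s → f χ + s) 0# characters

  syntax ∑-elements (λ u → e)   = ∑[ u ∈𝔽] e
  syntax ∑-characters (λ χ → e) = ∑[ χ ∈Ĝ] e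
  infix 3 ∑-elements ∑-characters

  -1ᶠ : F.Carrier
  -1ᶠ = F.- F.1#

  jacobi : Character → Character → K.Carrier
  jacobi χ ψ = ∑[ u ∈𝔽] χ ⟨ u ⟩ * ψ ⟨ F.1# F.- u ⟩

  binomial : Character → Character → K.Carrier
  binomial A B = B ⟨ -1ᶠ ⟩ * jacobi A (B ⁻¹)

  ₃F₂ : (A₀ A₁ A₂ B₁ B₂ : Character) → F.Carrier → K.Carrier
  ₃F₂ A₀ A₁ A₂ B₁ B₂ x = K.1/ (q ∸ 1) *
    (∑[ χ ∈Ĝ] binomial (A₀ ∙ χ) χ * binomial (A₁ ∙ χ) (B₁ ∙ χ) * binomial (A₂ ∙ χ) (B₂ ∙ χ) * χ ⟨ x ⟩)

  F₂ : (A B B′ C C′ : Character) → (x y : F.Carrier) → K.Carrier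
  F₂ A B B′ C C′ x y = ε ⟨ x F.* y ⟩ * (B ∙ B′ ∙ C ∙ C′) ⟨ -1ᶠ ⟩ *
    (∑[ u ∈𝔽] ∑[ v ∈𝔽] B ⟨ u ⟩ * B′ ⟨ v ⟩ * (B ⁻¹ ∙ C) ⟨ F.1# F.- u ⟩ * (B′ ⁻¹ ∙ C′) ⟨ F.1# F.- v ⟩
      * (A ⁻¹) ⟨ F.1# F.- u F.* x F.- v F.* y ⟩)

{-# OPTIONS --safe #-}
module Submission where

-- For x ≠ 0 the identity at y = 1 comes from expanding the last factor by
-- Greene's binomial theorem
--   Σ_χ binom(Aχ, χ) χ(t) = (q - 1) A⁻¹(1 - t)   (t ≠ 0)
-- at t = u x / (1 - v), where A⁻¹(1 - u x - v) = A⁻¹(1 - v) A⁻¹(1 - t).  The sums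
-- over u and v then separate into Jacobi sums, which J(A, B⁻¹) = A(-1) J(A, A⁻¹B)
-- turns into the binomial coefficients of ₃F₂.  The binomial theorem rests on
-- Σ_χ χ(t) = 0 for t ≠ 1, hence on a character χ with χ(t) ≠ 1; it is built by
-- extending a character of the subgroup generated by t one element at a time,
-- with roots extracted in K.  The sum vanishes as soon as it is not apart from 0,
-- so χ is only needed up to double negation and classical reasoning is available.

open import Defs
open import Algebra.Bundles using (AbelianGroup; CommutativeRing; CommutativeSemiring; Semiring)
import Algebra.Definitions.RawMonoid as RawMonoidDefinitions
import Algebra.Properties.AbelianGroup as AbelianGroupProperties
import Algebra.Properties.CommutativeSemigroup as CommutativeSemigroupProperties
import Algebra.Properties.CommutativeSemiring.Exp as CommutativeExp
import Algebra.Properties.Group as GroupProperties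
import Algebra.Properties.Ring as RingProperties
import Algebra.Properties.Semiring.Sum as Sum
import Algebra.Solver.CommutativeMonoid as CommutativeMonoidSolver
open import Data.Fin.Base as Fin using (Fin; punchIn)
import Data.Fin.Properties as Fin
open import Data.List.Base using (List; []; _∷_; foldr; length; lookup; replicate; tabulate)
open import Data.List.Membership.Propositional.Properties using (∈-lookup)
open import Data.List.Relation.Unary.All as All using (All; []; _∷_)
import Data.List.Relation.Unary.All.Properties as All
open import Data.List.Relation.Unary.AllPairs using (_∷_)
open import Data.List.Relation.Unary.Any as Any using ()
import Data.List.Relation.Unary.Any.Properties as Any
import Data.List.Relation.Unary.Enumerates.Setoid as Enumerates
import Data.List.Relation.Unary.Unique.Setoid as Unique
open import Data.Nat.Base as ℕ using (ℕ; zero; suc; _∸_; _!)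
open import Data.Nat.DivMod using (_/_; _%_; m≡m%n+[m/n]*n; m%n<n)
open import Data.Nat.Induction using (<-rec)
open import Data.Nat.Primality using (Prime)
import Data.Nat.Properties as ℕ
open import Data.Product.Base using (∃; _×_; _,_; proj₁; proj₂; map₂)
open import Function.Base using (_∘_)
open import Function.Bundles using (Inverse)
open import Function.Construct.Composition using (inverse)
open import Function.Construct.Symmetry using () renaming (inverse to symmetric)
open import Level using (_⊔_)
open import Relation.Binary.Bundles using (Setoid)
open import Relation.Binary.PropositionalEquality.Core as ≡ using (_≡_; _≢_)
import Relation.Binary.PropositionalEquality.Properties as ≡
import Relation.Binary.Reasoning.Setoid as ≈-Reasoning
open import Relation.Nullary.Decidable.Core using (Dec; yes; no)
open import Relation.Nullary.Negation.Core using (¬_; contradiction; ¬¬-map)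

-- Least witnesses and identities between powers

-- Strong induction: without a least witness, `P` fails at m as soon as it fails below m, hence
-- everywhere, also at n. The double negation is the price for not deciding `P`, which will be
-- membership of a power in a span.
¬¬-least : ∀ {p} (P : ℕ → Set p) n → P n → ¬ ¬ (∃ λ m → P m × (∀ {k} → k ℕ.< m → ¬ P k))
¬¬-least P n Pn none = <-rec _ (λ m below Pm → none (m , Pm , below)) n Pn

module _ {c ℓ} (S : CommutativeSemiring c ℓ) where
  open CommutativeSemiring S
  open CommutativeExp S
  open CommutativeSemigroupProperties *-commutativeSemigroup using (interchange)
  open ≈-Reasoning setoid

  ^*-merge : ∀ {g x y u v} k l → x ≈ g ^ k * u → y ≈ g ^ l * v → x * y ≈ g ^ (k ℕ.+ l) * (u * v)
  ^*-merge {g} {x} {y} {u} {v} k l x≈ y≈ = begin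
    x * y                      ≈⟨ *-cong x≈ y≈ ⟩
    g ^ k * u * (g ^ l * v)    ≈⟨ interchange _ _ _ _ ⟩
    g ^ k * g ^ l * (u * v)    ≈⟨ *-congʳ (^-homo-* g k l) ⟨
    g ^ (k ℕ.+ l) * (u * v)    ∎

  -- Serves division of the exponent k by n with remainder r: the part with exponent a multiple of n
  -- is absorbed into a span that contains g ^ n.
  y*[g^n]^d*g^r≈g^k*y : ∀ {g y k n} d r → k ≡ r ℕ.+ d ℕ.* n → y * (g ^ n) ^ d * g ^ r ≈ g ^ k * y
  y*[g^n]^d*g^r≈g^k*y {g} {y} {k} {n} d r k≡ = begin
    y * (g ^ n) ^ d * g ^ r         ≈⟨ *-assoc y _ _ ⟩
    y * ((g ^ n) ^ d * g ^ r)       ≈⟨ *-congˡ (*-congʳ (^-assocʳ g n d)) ⟩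
    y * (g ^ (n ℕ.* d) * g ^ r)     ≈⟨ *-congˡ (^-homo-* g (n ℕ.* d) r) ⟨
    y * g ^ (n ℕ.* d ℕ.+ r)         ≈⟨ *-congˡ (^-congʳ g nd+r≡k) ⟩
    y * g ^ k                       ≈⟨ *-comm y _ ⟩
    g ^ k * y                       ∎
    where
    nd+r≡k : n ℕ.* d ℕ.+ r ≡ k
    nd+r≡k = ≡.trans (ℕ.+-comm (n ℕ.* d) r)
      (≡.trans (≡.cong (r ℕ.+_) (ℕ.*-comm n d)) (≡.sym k≡))

-- Bijections and enumerations of setoids

module _ {a ℓ} (S : Setoid a ℓ) where
  open Setoid S

  mkInverse : (f g : Carrier → Carrier) → (∀ {x y} → x ≈ y → f x ≈ f y) →
    (∀ {x y} → x ≈ y → g x ≈ g y) → (∀ x → f (g x) ≈ x) → (∀ x → g (f x) ≈ x) → Inverse S S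
  mkInverse f g f-cong g-cong fg gf = record
    { to        = f
    ; from      = g
    ; to-cong   = f-cong
    ; from-cong = g-cong
    ; inverse   = (λ eq → trans (f-cong eq) (fg _)) , (λ eq → trans (g-cong eq) (gf _))
    }

  lookup-injective : ∀ {xs} → Unique.Unique S xs → ∀ i j → lookup xs i ≈ lookup xs j → i ≡ j
  lookup-injective (_ ∷ _)   Fin.zero    Fin.zero    _  = ≡.refl
  lookup-injective (x∉ ∷ _)  Fin.zero    (Fin.suc j) eq = contradiction eq (All.lookup x∉ (∈-lookup j))
  lookup-injective (x∉ ∷ _)  (Fin.suc i) Fin.zero    eq = contradiction (sym eq) (All.lookup x∉ (∈-lookup i))
  lookup-injective (_ ∷ !xs) (Fin.suc i) (Fin.suc j) eq = ≡.cong Fin.suc (lookup-injective !xs i j eq)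

  -- Completeness supplies a position for each element. The absence of repetitions makes that
  -- position independent of the representative and gives both inverse laws.
  lookup-enumeration : ∀ {xs} → Enumerates.IsEnumeration S xs → Unique.Unique S xs →
    Inverse (≡.setoid (Fin (length xs))) S
  lookup-enumeration {xs} all !xs = record
    { to        = lookup xs
    ; from      = λ x → Any.index (all x)
    ; to-cong   = λ { ≡.refl → refl }
    ; from-cong = λ {x} {y} x≈y → lookup-injective !xs _ _
        (trans (lookup-index x) (trans x≈y (sym (lookup-index y))))
    ; inverse   = (λ { {x} ≡.refl → lookup-index x })
                , (λ {i} {x} x≈ → lookup-injective !xs _ _ (trans (lookup-index x) x≈))
    }
    where
    lookup-index : ∀ x → lookup xs (Any.index (all x)) ≈ x
    lookup-index x = sym (Any.lookup-index (all x))

-- Finite sums over enumerated setoids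

module _ {c ℓ} (R : Semiring c ℓ) where
  open Semiring R hiding (zero)
  open Sum R
  open RawMonoidDefinitions +-rawMonoid using () renaming (_×_ to _·_)

  sum-zero : ∀ {n} {f : Fin n → Carrier} → (∀ i → f i ≈ 0#) → sum f ≈ 0#
  sum-zero {n} f≈0 = trans (sum-cong-≋ f≈0) (sum-replicate-zero n)

  sum-support : ∀ {n} (f : Fin n → Carrier) i → (∀ j → j ≢ i → f j ≈ 0#) → sum f ≈ f i
  sum-support {suc n} f i f≈0 = trans (sum-remove {i = i} f)
    (trans (+-congˡ (sum-zero λ j → f≈0 (punchIn i j) (Fin.punchInᵢ≢i i j))) (+-identityʳ _))

  sum-cosupport : ∀ {n} (f : Fin n → Carrier) i → f i ≈ 0# → (∀ j → j ≢ i → f j ≈ 1#) →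
    sum f ≈ (n ∸ 1) · 1#
  sum-cosupport {suc n} f i f≈0 f≈1 = trans (sum-remove {i = i} f)
    (trans (+-cong f≈0 (trans (sum-cong-≋ λ j → f≈1 (punchIn i j) (Fin.punchInᵢ≢i i j))
      (sum-replicate n))) (+-identityˡ _))

  foldr≡sum : ∀ {a} {A : Set a} (f : A → Carrier) xs →
    foldr (λ x s → f x + s) 0# xs ≡ sum (f ∘ lookup xs)
  foldr≡sum f []       = ≡.refl
  foldr≡sum f (x ∷ xs) = ≡.cong (f x +_) (foldr≡sum f xs)

  module EnumeratedSum {a ℓ′} {S : Setoid a ℓ′} {n} (E : Inverse (≡.setoid (Fin n)) S) where
    private
      module S = Setoid S
    open Inverse E using (to; from; from-cong; strictlyInverseˡ; strictlyInverseʳ)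

    private
      to≈⇒≡from : ∀ {i x} → to i S.≈ x → i ≡ from x
      to≈⇒≡from {i} eq = ≡.trans (≡.sym (strictlyInverseʳ i)) (from-cong eq)

    -- Opaque, so that the summand can be inferred from the sum.
    opaque
      ∑ : (S.Carrier → Carrier) → Carrier
      ∑ f = sum (f ∘ to)

      sum≈∑ : ∀ f → sum (f ∘ to) ≈ ∑ f
      sum≈∑ f = refl

      ∑-cong : ∀ {f g} → (∀ x → f x ≈ g x) → ∑ f ≈ ∑ g
      ∑-cong f≈g = sum-cong-≋ (f≈g ∘ to)

      ∑-zero : ∀ {f} → (∀ x → f x ≈ 0#) → ∑ f ≈ 0#
      ∑-zero f≈0 = sum-zero (f≈0 ∘ to)

      ∑-support : ∀ {f} → (∀ {x y} → x S.≈ y → f x ≈ f y) → ∀ x →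
        (∀ y → ¬ (y S.≈ x) → f y ≈ 0#) → ∑ f ≈ f x
      ∑-support f-cong x f≈0 = trans
        (sum-support _ (from x) (λ j j≢ → f≈0 (to j) (j≢ ∘ to≈⇒≡from)))
        (f-cong (strictlyInverseˡ x))

      ∑-cosupport : ∀ {f} → (∀ {x y} → x S.≈ y → f x ≈ f y) → ∀ x →
        f x ≈ 0# → (∀ y → ¬ (y S.≈ x) → f y ≈ 1#) → ∑ f ≈ (n ∸ 1) · 1#
      ∑-cosupport f-cong x f≈0 f≈1 =
        sum-cosupport _ (from x) (trans (f-cong (strictlyInverseˡ x)) f≈0)
          (λ j j≢ → f≈1 (to j) (j≢ ∘ to≈⇒≡from))

      ∑-reindex : ∀ {f} → (∀ {x y} → x S.≈ y → f x ≈ f y) → (σ : Inverse S S) →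
        ∑ f ≈ ∑ (f ∘ Inverse.to σ)
      ∑-reindex {f} f-cong σ = trans
        -- Conjugating σ by the enumeration turns it into a permutation of the indices.
        (sum-permute (f ∘ to) (inverse (inverse E σ) (symmetric E)))
        (sum-cong-≋ λ i → f-cong (strictlyInverseˡ (Inverse.to σ (to i))))

      *-distribˡ-∑ : ∀ a f → a * ∑ f ≈ ∑ (λ x → a * f x)
      *-distribˡ-∑ a f = *-distribˡ-sum a (f ∘ to)

      *-distribʳ-∑ : ∀ a f → ∑ f * a ≈ ∑ (λ x → f x * a)
      *-distribʳ-∑ a f = *-distribʳ-sum a (f ∘ to)

  opaque
    unfolding EnumeratedSum.∑

    ∑-swap : ∀ {a b ℓ₁ ℓ₂ m n} {S : Setoid a ℓ₁} {T : Setoid b ℓ₂}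
      (E : Inverse (≡.setoid (Fin m)) S) (E′ : Inverse (≡.setoid (Fin n)) T)
      (f : Setoid.Carrier S → Setoid.Carrier T → Carrier) →
      EnumeratedSum.∑ E (λ x → EnumeratedSum.∑ E′ (f x)) ≈
      EnumeratedSum.∑ E′ (λ y → EnumeratedSum.∑ E (λ x → f x y))
    ∑-swap E E′ f = ∑-comm (λ i j → f (Inverse.to E i) (Inverse.to E′ j))

-- Identities and substitutions in a finite field

module _ {q c₁ ℓ₁} (F : FiniteField q c₁ ℓ₁) where
  open FiniteField F
  open RingProperties ring using (x[y-z]≈xy-xz; -1*x≈-x; -‿involutive)
  open GroupProperties +-group using (⁻¹-anti-homo-//)
  open AbelianGroupProperties +-abelianGroup using (xyx⁻¹≈y)
  open CommutativeSemigroupProperties +-commutativeSemigroup using (xy∙z≈xz∙y)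
  open CommutativeSemigroupProperties *-commutativeSemigroup using () renaming (x∙yz≈y∙xz to x*yz≈y*xz)
  open ≈-Reasoning setoid

  x+[y-x]≈y : ∀ x y → x + (y - x) ≈ y
  x+[y-x]≈y x y = trans (sym (+-assoc x y (- x))) (xyx⁻¹≈y x y)

  1-[1-x]≈x : ∀ x → 1# - (1# - x) ≈ x
  1-[1-x]≈x x = trans (+-congˡ (⁻¹-anti-homo-// 1# x)) (x+[y-x]≈y 1# x)

  -1*-1≈1 : - 1# * - 1# ≈ 1#
  -1*-1≈1 = trans (-1*x≈-x (- 1#)) (-‿involutive 1#)

  inv-inverseˡ : ∀ {x} → ¬ (x ≈ 0#) → inv x * x ≈ 1#
  inv-inverseˡ x≉0 = trans (*-comm _ _) (inv-inverseʳ F x≉0)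

  x*y≈1⇒x≉0 : ∀ {x y} → x * y ≈ 1# → ¬ (x ≈ 0#)
  x*y≈1⇒x≉0 xy≈1 x≈0 = 1≉0 (trans (sym xy≈1) (trans (*-congʳ x≈0) (zeroˡ _)))

  inv-involutive : ∀ x → inv (inv x) ≈ x
  inv-involutive x = helper (x ≟ 0#)
    where
    helper : Dec (x ≈ 0#) → inv (inv x) ≈ x
    helper (yes x≈0) = trans (inv-0 F (inv-0 F x≈0)) (sym x≈0)
    helper (no x≉0)  = inv-unique F (x*y≈1⇒x≉0 (inv-inverseˡ x≉0)) (inv-inverseˡ x≉0)

  1-inv : ∀ {x} → ¬ (x ≈ 0#) → 1# - inv x ≈ - 1# * (inv x * (1# - x))
  1-inv {x} x≉0 = sym (begin
    - 1# * (inv x * (1# - x))         ≈⟨ -1*x≈-x _ ⟩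
    - (inv x * (1# - x))              ≈⟨ -‿cong (x[y-z]≈xy-xz (inv x) 1# x) ⟩
    - (inv x * 1# - inv x * x)        ≈⟨ ⁻¹-anti-homo-// _ _ ⟩
    inv x * x - inv x * 1#            ≈⟨ +-cong (inv-inverseˡ x≉0) (-‿cong (*-identityʳ _)) ⟩
    1# - inv x                        ∎)

  1-a-b≈[1-b][1-a/[1-b]] : ∀ a b → ¬ (1# - b ≈ 0#) → 1# - a - b ≈ (1# - b) * (1# - a * inv (1# - b))
  1-a-b≈[1-b][1-a/[1-b]] a b w≉0 = begin
    1# - a - b                      ≈⟨ xy∙z≈xz∙y 1# (- a) (- b) ⟩
    w - a                           ≈⟨ +-cong (*-identityʳ w) (-‿cong w[a/w]≈a) ⟨
    w * 1# - w * (a * inv w)        ≈⟨ x[y-z]≈xy-xz w 1# _ ⟨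
    w * (1# - a * inv w)            ∎
    where
    w : Carrier
    w = 1# - b
    w[a/w]≈a : w * (a * inv w) ≈ a
    w[a/w]≈a = trans (x*yz≈y*xz w a (inv w)) (trans (*-congˡ (inv-inverseʳ F w≉0)) (*-identityʳ a))

  -- The argument of χ in χ(-1) χ(s) χ⁻¹(1 - s) χ(t).
  ratio : Carrier → Carrier → Carrier
  ratio t s = - 1# * (s * t) * inv (1# - s)

  ratio-cong : ∀ t {r s} → r ≈ s → ratio t r ≈ ratio t s
  ratio-cong t r≈s = *-cong (*-congˡ (*-congʳ r≈s)) (inv-cong F (+-congˡ (-‿cong r≈s)))

  s[1-t]≈s+-1*st : ∀ s t → s * (1# - t) ≈ s + - 1# * (s * t)
  s[1-t]≈s+-1*st s t = trans (x[y-z]≈xy-xz s 1# t) (+-cong (*-identityʳ s) (sym (-1*x≈-x _)))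

  -- Clearing the denominator turns the hypothesis into -st = 1 - s. Hence at most one s contributes
  -- to the sum in `binomial-theorem`, and none if t = 1.
  ratio≈1⇒ : ∀ {s t} → ratio t s ≈ 1# → s * (1# - t) ≈ 1#
  ratio≈1⇒ {s} {t} r≈1 = begin
    s * (1# - t)            ≈⟨ s[1-t]≈s+-1*st s t ⟩
    s + y                   ≈⟨ +-congˡ y≈w ⟩
    s + w                   ≈⟨ x+[y-x]≈y s 1# ⟩
    1#                      ∎
    where
    w y : Carrier
    w = 1# - s
    y = - 1# * (s * t)
    -- As `inv` sends 0 to 0, a vanishing denominator would make the ratio 0 instead of 1.
    w≉0 : ¬ (w ≈ 0#)
    w≉0 w≈0 = 1≉0 (trans (sym r≈1) (trans (*-congˡ (inv-0 F w≈0)) (zeroʳ y)))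
    y≈w : y ≈ w
    y≈w = begin
      y                ≈⟨ *-identityʳ y ⟨
      y * 1#           ≈⟨ *-congˡ (inv-inverseʳ F w≉0) ⟨
      y * (w * inv w)  ≈⟨ x*yz≈y*xz y w (inv w) ⟩
      w * (y * inv w)  ≈⟨ *-congˡ r≈1 ⟩
      w * 1#           ≈⟨ *-identityʳ w ⟩
      w                ∎

  ratio≈1⇐ : ∀ {s t} → ¬ (t ≈ 0#) → s * (1# - t) ≈ 1# → ratio t s ≈ 1#
  ratio≈1⇐ {s} {t} t≉0 eq = trans (*-congʳ y≈w) (inv-inverseʳ F w≉0)
    where
    w y : Carrier
    w = 1# - s
    y = - 1# * (s * t)
    y≈w : y ≈ w
    y≈w = sym (trans (+-congʳ (trans (sym eq) (s[1-t]≈s+-1*st s t))) (xyx⁻¹≈y s y))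
    -- Here 1 - s equals -st, whose factors are all nonzero: s because s(1 - t) = 1, and t by
    -- hypothesis.
    w≉0 : ¬ (w ≈ 0#)
    w≉0 = *-≉0 F (x*y≈1⇒x≉0 -1*-1≈1) (*-≉0 F (x*y≈1⇒x≉0 eq) t≉0) ∘ trans y≈w

  reflection : Inverse setoid setoid
  reflection = mkInverse setoid (λ x → 1# - x) (λ x → 1# - x) flip-cong flip-cong 1-[1-x]≈x 1-[1-x]≈x
    where
    flip-cong : ∀ {x y} → x ≈ y → 1# - x ≈ 1# - y
    flip-cong = +-congˡ ∘ -‿cong

  inversion : Inverse setoid setoid
  inversion = mkInverse setoid inv inv (inv-cong F) (inv-cong F) inv-involutive inv-involutive

  dilation : ∀ {a} → ¬ (a ≈ 0#) → Inverse setoid setoid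
  dilation {a} a≉0 = mkInverse setoid (a *_) (inv a *_) *-congˡ *-congˡ
    (cancel (inv-inverseʳ F a≉0)) (cancel (inv-inverseˡ a≉0))
    where
    cancel : ∀ {x y} → x * y ≈ 1# → ∀ z → x * (y * z) ≈ z
    cancel xy≈1 z = trans (sym (*-assoc _ _ z)) (trans (*-congʳ xy≈1) (*-identityˡ z))

module _ {q c₁ ℓ₁ c₂ ℓ₂ ℓ₃} (F : FiniteField q c₁ ℓ₁) (K : AlgClosedField₀ c₂ ℓ₂ ℓ₃) where
  private
    module F = FiniteField F
    module K = AlgClosedField₀ K
    module KR = CommutativeRing K.commutativeRing
  open K using (_≈_; _+_; _*_; 0#; 1#)
  open Characters F K
  open Character using (eval-cong; eval-*; eval-1)
  private
    module Ĝ = AbelianGroup characterGroup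
  open CommutativeExp K.commutativeSemiring using (_^_; ^-congˡ; ^-congʳ; ^-assocʳ)
  open CommutativeExp F.commutativeSemiring using ()
    renaming (_^_ to _^ᶠ_; ^-congʳ to ^ᶠ-congʳ)
  open RootsOfUnity K using (#0⇒*-cancelʳ; geometric; geometric-telescope; geometric-1)
  open GroupProperties KR.+-group using (∙-cancelˡ)
  open CommutativeMonoidSolver KR.*-commutativeMonoid using (solve; _⊕_; _⊜_)
  open ≈-Reasoning K.setoid

  -- Roots in the field of values

  ¬#0⇒≈0 : ∀ {a} → ¬ (a K.# 0#) → a ≈ 0#
  ¬#0⇒≈0 = proj₁ (K.tight _ _)

  nth-root : ∀ m b → ∃ λ w → w ^ suc m ≈ b
  -- The monic polynomial with lower coefficients -b, 0, ..., 0 is z ^ (m + 1) - b.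
  nth-root m b with K.root (K.- b) (replicate m 0#)
  ... | w , P≈0 = w , ∙-cancelˡ (K.- b) _ _ (begin
    K.- b + w ^ suc m                                           ≈⟨ K.+-congˡ (K.*-congˡ (lemma m)) ⟨
    K.- b + w * monic K.commutativeRing (replicate m 0#) w      ≈⟨ P≈0 ⟩
    0#                                                          ≈⟨ K.-‿inverseˡ b ⟨
    K.- b + b                                                   ∎)
    where
    lemma : ∀ n → monic K.commutativeRing (replicate n 0#) w ≈ w ^ n
    lemma zero    = K.refl
    lemma (suc n) = K.trans (K.+-identityˡ _) (K.*-congˡ (lemma n))

  -- A root of 1 + z + … + z ^ (m + 1).
  nontrivial-root-of-unity : ∀ m → ∃ λ w → w ^ suc (suc m) ≈ 1# × ¬ (w ≈ 1#)
  nontrivial-root-of-unity m with K.root 1# (replicate m 1#)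
  ... | w , P≈0 = w , w^n≈1 , w≉1
    where
    n : ℕ
    n = suc (suc m)
    lemma : ∀ k → geometric w (suc k) ≈ monic K.commutativeRing (replicate k 1#) w
    lemma zero    = K.trans (K.+-congˡ (K.zeroʳ w)) (K.+-identityʳ 1#)
    lemma (suc k) = K.+-congˡ (K.*-congˡ (lemma k))
    G≈0 : geometric w n ≈ 0#
    G≈0 = K.trans (lemma (suc m)) P≈0
    w^n≈1 : w ^ n ≈ 1#
    w^n≈1 = begin
      w ^ n                    ≈⟨ K.+-identityˡ _ ⟨
      0# + w ^ n               ≈⟨ K.+-congʳ G≈0 ⟨
      geometric w n + w ^ n    ≈⟨ geometric-telescope w n ⟨
      w * geometric w n + 1#   ≈⟨ K.+-congʳ (K.trans (K.*-congˡ G≈0) (K.zeroʳ w)) ⟩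
      0# + 1#                  ≈⟨ K.+-identityˡ 1# ⟩
      1#                       ∎
    w≉1 : ¬ (w ≈ 1#)
    w≉1 w≈1 = K.#-irrefl (K.trans (K.sym (geometric-1 w≈1 n)) G≈0) (K.char-0 n)

  -- Extension of characters from subgroups

  -- A finite set of pairs (g , w) prescribes the values w of a character at
  -- the elements g.  Span is the subgroup of 𝔽* × K* that it generates, and
  -- the prescription is consistent if this subgroup is the graph of a map.
  data Span : List (F.Carrier × K.Carrier) → F.Carrier → K.Carrier → Set (c₁ ⊔ ℓ₁ ⊔ c₂ ⊔ ℓ₂) where
    base : ∀ {x a} → x F.≈ F.1# → a ≈ 1# → Span [] x a
    step : ∀ {g w ps x y a b} k → Span ps y b → x F.≈ g ^ᶠ k F.* y → a ≈ w ^ k * b →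
           Span ((g , w) ∷ ps) x a

  Consistent : List (F.Carrier × K.Carrier) → Set (c₁ ⊔ ℓ₁ ⊔ c₂ ⊔ ℓ₂)
  Consistent ps = ∀ {x a} → Span ps x a → x F.≈ F.1# → a ≈ 1#

  span-resp : ∀ {ps x y a b} → x F.≈ y → a ≈ b → Span ps x a → Span ps y b
  span-resp x≈y a≈b (base x≈ a≈)     = base (F.trans (F.sym x≈y) x≈) (K.trans (K.sym a≈b) a≈)
  span-resp x≈y a≈b (step k s x≈ a≈) =
    step k s (F.trans (F.sym x≈y) x≈) (K.trans (K.sym a≈b) a≈)

  span-∷ : ∀ {p ps x a} → Span ps x a → Span (p ∷ ps) x a
  span-∷ s = step 0 s (F.sym (F.*-identityˡ _)) (K.sym (K.*-identityˡ _))

  span-1 : ∀ ps → Span ps F.1# 1#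
  span-1 []       = base F.refl K.refl
  span-1 (_ ∷ ps) = span-∷ (span-1 ps)

  span-here : ∀ g w ps → Span ((g , w) ∷ ps) g w
  span-here g w ps = step 1 (span-1 ps)
    (F.sym (F.trans (F.*-identityʳ _) (F.*-identityʳ g)))
    (K.sym (K.trans (K.*-identityʳ _) (K.*-identityʳ w)))

  span-* : ∀ {ps x y a b} → Span ps x a → Span ps y b → Span ps (x F.* y) (a * b)
  span-* (base x≈ a≈) (base y≈ b≈) = base
    (F.trans (F.*-cong x≈ y≈) (F.*-identityˡ F.1#)) (K.trans (K.*-cong a≈ b≈) (K.*-identityˡ 1#))
  span-* (step k s x≈ a≈) (step l t y≈ b≈) = step (k ℕ.+ l) (span-* s t)
    (^*-merge F.commutativeSemiring k l x≈ y≈) (^*-merge K.commutativeSemiring k l a≈ b≈)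

  span-^ : ∀ {ps x a} → Span ps x a → ∀ n → Span ps (x ^ᶠ n) (a ^ n)
  span-^ {ps} s zero    = span-1 ps
  span-^      s (suc n) = span-* s (span-^ s n)

  private
    M : ℕ
    M = ℕ.pred (q !)

    x*x^M≈1 : ∀ {x} → ¬ (x F.≈ F.0#) → x F.* x ^ᶠ M F.≈ F.1#
    x*x^M≈1 {x} x≉0 =
      F.trans (^ᶠ-congʳ x (ℕ.suc-pred (q !) {{ℕ._!≢0 q}})) (^-q!≈1 F x≉0)

  -- The exponents in `Span` are natural numbers, so closure under inverses needs finite order: x ^
  -- (q !) = 1 makes x ^ M, with M = q! - 1, the inverse of x.
  span-inverse : ∀ {ps x y a} → x F.* y F.≈ F.1# → Span ps x a → Span ps y (a ^ M)
  span-inverse xy≈1 s = span-resp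
    (*-cancelˡ-≉0 F x≉0 (F.trans (x*x^M≈1 x≉0) (F.sym xy≈1))) K.refl (span-^ s M)
    where
    x≉0 = x*y≈1⇒x≉0 F xy≈1

  -- An element g becomes consistent with value w once w ^ n has the value
  -- prescribed at the first power g ^ n that lies in the span.
  consistent-∷ : ∀ {ps g w b} m → Consistent ps → Span ps (g ^ᶠ suc m) b →
    (∀ {k} → k ℕ.< m → ¬ (∃ (Span ps (g ^ᶠ suc k)))) → w ^ suc m ≈ b →
    Consistent ((g , w) ∷ ps)
  consistent-∷ {ps} {g} {w} {b} m con s least w^n≈b {a = a} (step {y = y} {b = b′} k t x≈ a≈) x≈1 =
    go (k % n) (m%n<n k n) (m≡m%n+[m/n]*n k n)
    where
    n d : ℕ
    n = suc m
    d = k / n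
    z : F.Carrier
    z = y F.* (g ^ᶠ n) ^ᶠ d
    span-z : Span ps z (b′ * b ^ d)
    span-z = span-* t (span-^ s d)
    zg^r≈1 : ∀ r → k ≡ r ℕ.+ d ℕ.* n → z F.* g ^ᶠ r F.≈ F.1#
    zg^r≈1 r k≡ = F.trans (y*[g^n]^d*g^r≈g^k*y F.commutativeSemiring d r k≡) (F.trans (F.sym x≈) x≈1)
    go : ∀ r → r ℕ.< n → k ≡ r ℕ.+ d ℕ.* n → a ≈ 1#
    -- A nonzero remainder would put g ^ (r + 1) in the span, as the inverse of `z`, although r + 1
    -- is below the first such exponent n.
    go (suc r) (ℕ.s≤s r<m) k≡ =
      contradiction (_ , span-inverse (zg^r≈1 (suc r) k≡) span-z) (least r<m)
    go zero _ k≡ = begin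
      a                       ≈⟨ a≈ ⟩
      w ^ k * b′              ≈⟨ K.*-congʳ (^-congʳ w (≡.trans k≡ (ℕ.*-comm d n))) ⟩
      w ^ (n ℕ.* d) * b′      ≈⟨ K.*-congʳ (^-assocʳ w n d) ⟨
      (w ^ n) ^ d * b′        ≈⟨ K.*-congʳ (^-congˡ d w^n≈b) ⟩
      b ^ d * b′              ≈⟨ K.*-comm _ b′ ⟩
      b′ * b ^ d              ≈⟨ con span-z (F.trans (F.sym (F.*-identityʳ z)) (zg^r≈1 0 k≡)) ⟩
      1#                      ∎

  -- Some power of g always lies in the span, because q! = M + 1 is an exponent of the unit group.
  -- This starts the search for the least one.
  span-power : ∀ ps {g} → ¬ (g F.≈ F.0#) → ∃ (Span ps (g ^ᶠ suc M))
  span-power ps g≉0 = 1# , span-resp (F.sym (x*x^M≈1 g≉0)) K.refl (span-1 ps)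

  extend : ∀ {ps g} → ¬ (g F.≈ F.0#) → Consistent ps → ¬ ¬ (∃ λ w → Consistent ((g , w) ∷ ps))
  extend {ps} {g} g≉0 con = ¬¬-map
    (λ { (m , (b , s) , least) → let w , w^n≈b = nth-root m b in
         w , λ {x} {a} → consistent-∷ m con s least w^n≈b {x} {a} })
    (¬¬-least (λ k → ∃ (Span ps (g ^ᶠ suc k))) M (span-power ps g≉0))

  -- The span of the empty list is trivial, so the first power of t in it is given by the order n of
  -- t. Any n-th root of unity is then an admissible value at t, and since t ≠ 1 gives n ≥ 2, one
  -- different from 1 exists.
  separate₀ : ∀ {t} → ¬ (t F.≈ F.0#) → ¬ (t F.≈ F.1#) →
    ¬ ¬ (∃ λ w → Consistent ((t , w) ∷ []) × ¬ (w ≈ 1#))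
  separate₀ {t} t≉0 t≉1 = ¬¬-map choose (¬¬-least (λ k → ∃ (Span [] (t ^ᶠ suc k))) M (span-power [] t≉0))
    where
    con₀ : Consistent []
    con₀ (base _ a≈1) _ = a≈1
    choose : (∃ λ m → (∃ (Span [] (t ^ᶠ suc m))) ×
               (∀ {k} → k ℕ.< m → ¬ (∃ (Span [] (t ^ᶠ suc k))))) →
             ∃ λ w → Consistent ((t , w) ∷ []) × ¬ (w ≈ 1#)
    choose (zero , (_ , base t≈1 _) , _) = contradiction (F.trans (F.sym (F.*-identityʳ t)) t≈1) t≉1
    choose (suc m , (_ , s@(base _ b≈1)) , least) with nontrivial-root-of-unity m
    ... | w , w^n≈1 , w≉1 =
      w , (λ {x} {a} → consistent-∷ (suc m) con₀ s least (K.trans w^n≈1 (K.sym b≈1)) {x} {a}) , w≉1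

  -- Vacuous at 0, where every character takes the value 0 by convention, so that lists of field
  -- elements may contain 0.
  Defined : List (F.Carrier × K.Carrier) → F.Carrier → Set (c₁ ⊔ ℓ₁ ⊔ c₂ ⊔ ℓ₂)
  Defined ps g = ¬ (g F.≈ F.0#) → ∃ (Span ps g)

  defined-∷ : ∀ {p ps g} → Defined ps g → Defined (p ∷ ps) g
  defined-∷ def g≉0 = map₂ span-∷ (def g≉0)

  -- Finitely many double negations combine: each stage aims at a contradiction, so the extension
  -- given by `extend` may be unpacked there. Spans only grow, which preserves the value w at t and
  -- the elements already treated.
  extend-all : ∀ gs {ps t w} → Consistent ps → Span ps t w →
    ¬ ¬ (∃ λ ps′ → Consistent ps′ × Span ps′ t w × All (Defined ps′) gs)
  extend-all []       {ps} con s none = none (ps , (λ {x} {a} → con {x} {a}) , s , [])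
  extend-all (g ∷ gs) con s none = extend-all gs con s λ { (ps , con′ , s′ , defined) →
    adjoin ps con′ s′ defined (g F.≟ F.0#) }
    where
    adjoin : ∀ ps → Consistent ps → Span ps _ _ → All (Defined ps) gs → ¬ (Dec (g F.≈ F.0#))
    adjoin ps con′ s′ defined (yes g≈0) =
      none (ps , (λ {x} {a} → con′ {x} {a}) , s′ , (λ g≉0 → contradiction g≈0 g≉0) ∷ defined)
    adjoin ps con′ s′ defined (no g≉0)  = extend g≉0 con′ λ { (w , con″) →
      none ((g , w) ∷ ps , (λ {x} {a} → con″ {x} {a}) , span-∷ s′ ,
        (λ _ → w , span-here g w ps) ∷ All.map defined-∷ defined) }

  -- Consistency speaks only about values at 1. It applies to y · y ^ M and to x · y ^ M, which are
  -- both 1, so b · b ^ M and a · b ^ M are both 1 as well.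
  span-functional : ∀ {ps} → Consistent ps → ∀ {x y a b} → ¬ (x F.≈ F.0#) → x F.≈ y →
    Span ps x a → Span ps y b → a ≈ b
  span-functional con {x} {y} {a} {b} x≉0 x≈y s t = begin
    a                ≈⟨ K.*-identityʳ a ⟨
    a * 1#           ≈⟨ K.*-congˡ (con (span-^ t (suc M)) (x*x^M≈1 y≉0)) ⟨
    a * (b * b ^ M)  ≈⟨ x∙yz≈y∙xz a b (b ^ M) ⟩
    b * (a * b ^ M)  ≈⟨ K.*-congˡ (con (span-* s (span-^ t M)) (F.trans (F.*-congʳ x≈y) (x*x^M≈1 y≉0))) ⟩
    b * 1#           ≈⟨ K.*-identityʳ b ⟩
    b                ∎
    where
    open CommutativeSemigroupProperties K.*-commutativeSemigroup using (x∙yz≈y∙xz)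
    y≉0 = x≉0 ∘ F.trans x≈y

  -- By `span-functional` the value does not depend on how an element was reached in the span, so
  -- `span-*` makes it multiplicative.
  span-character : ∀ {ps} → Consistent ps → (∀ x → Defined ps x) →
    ∃ λ χ → ∀ {x a} → ¬ (x F.≈ F.0#) → Span ps x a → χ ⟨ x ⟩ ≈ a
  span-character {ps} con defined = character , value-unique
    where
    value : ∀ {x} → Dec (x F.≈ F.0#) → K.Carrier
    value     (yes _)  = 0#
    value {x} (no x≉0) = proj₁ (defined x x≉0)

    f : F.Carrier → K.Carrier
    f x = value (x F.≟ F.0#)

    f-0 : ∀ {x} → x F.≈ F.0# → f x ≈ 0#
    f-0 {x} x≈0 with x F.≟ F.0#
    ... | yes _  = K.refl
    ... | no x≉0 = contradiction x≈0 x≉0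

    f-span : ∀ {x} → ¬ (x F.≈ F.0#) → Span ps x (f x)
    f-span {x} x≉0 with x F.≟ F.0#
    ... | yes x≈0 = contradiction x≈0 x≉0
    ... | no x≉0′ = proj₂ (defined x x≉0′)

    value-unique : ∀ {x a} → ¬ (x F.≈ F.0#) → Span ps x a → f x ≈ a
    value-unique x≉0 s = span-functional con x≉0 F.refl (f-span x≉0) s

    f-cong : ∀ {x y} → x F.≈ y → f x ≈ f y
    f-cong {x} {y} x≈y with y F.≟ F.0#
    ... | yes y≈0 = f-0 (F.trans x≈y y≈0)
    ... | no y≉0  = value-unique (y≉0 ∘ F.trans (F.sym x≈y))
      (span-resp (F.sym x≈y) K.refl (proj₂ (defined y y≉0)))

    f-* : ∀ x y → f (x F.* y) ≈ f x * f y
    f-* x y = helper (x F.≟ F.0#) (y F.≟ F.0#)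
      where
      helper : Dec (x F.≈ F.0#) → Dec (y F.≈ F.0#) → f (x F.* y) ≈ f x * f y
      helper (yes x≈0) _ = K.trans (f-0 (F.trans (F.*-congʳ x≈0) (F.zeroˡ y)))
        (K.sym (K.trans (K.*-congʳ (f-0 x≈0)) (K.zeroˡ _)))
      helper (no _) (yes y≈0) = K.trans (f-0 (F.trans (F.*-congˡ y≈0) (F.zeroʳ x)))
        (K.sym (K.trans (K.*-congˡ (f-0 y≈0)) (K.zeroʳ _)))
      helper (no x≉0) (no y≉0) =
        value-unique (*-≉0 F x≉0 y≉0) (span-* (f-span x≉0) (f-span y≉0))

    character : Character
    character = mkCharacter f f-cong f-* (value-unique F.1≉0 (span-1 ps)) (f-0 F.refl)

  separate : ∀ {t} → ¬ (t F.≈ F.0#) → ¬ (t F.≈ F.1#) → ¬ ¬ (∃ λ χ → ¬ (χ ⟨ t ⟩ ≈ 1#))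
  separate {t} t≉0 t≉1 none = separate₀ t≉0 t≉1 λ { (w , con , w≉1) →
    extend-all (tabulate F.element) con (span-here t w []) λ { (ps , con′ , s , defined) →
      let χ , χ≈ = span-character con′ (λ x x≉0 →
            let a , s′ = All.tabulate⁻ defined (F.index x) (x≉0 ∘ F.trans (F.sym (F.element-index x)))
            in a , span-resp (F.element-index x) K.refl s′)
      in none (χ , w≉1 ∘ K.trans (K.sym (χ≈ t≉0 s))) } }

  -- Orthogonality of characters

  Ĝ-enumeration : Inverse (≡.setoid (Fin (length characters))) Ĝ.setoid
  Ĝ-enumeration = lookup-enumeration Ĝ.setoid characters-complete characters-unique

  private
    module 𝔽 = EnumeratedSum K.semiring F.enumeration
    module Ĝ∑ = EnumeratedSum K.semiring Ĝ-enumeration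

  ∑-characters≈ : ∀ f → ∑-characters f ≈ Ĝ∑.∑ f
  ∑-characters≈ f = K.trans (K.reflexive (foldr≡sum K.semiring f characters)) (Ĝ∑.sum≈∑ f)

  translation : Character → Inverse Ĝ.setoid Ĝ.setoid
  translation χ = mkInverse Ĝ.setoid (χ ∙_) (χ ⁻¹ ∙_)
    (λ {ψ} {φ} → Ĝ.∙-congˡ {χ} {ψ} {φ}) (λ {ψ} {φ} → Ĝ.∙-congˡ {χ ⁻¹} {ψ} {φ})
    (Ĝ-cancel χ (χ ⁻¹) (Ĝ.inverseʳ χ)) (Ĝ-cancel (χ ⁻¹) χ (Ĝ.inverseˡ χ))
    where
    Ĝ-cancel : ∀ χ ψ → (χ ∙ ψ) ≋ ε → ∀ φ → (χ ∙ (ψ ∙ φ)) ≋ φ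
    Ĝ-cancel χ ψ χψ≋ε φ x = K.trans (K.sym (K.*-assoc _ _ _))
      (K.trans (K.*-congʳ (χψ≋ε x)) (Ĝ.identityˡ φ x))

  -- Replacing u by xu for x ≠ 0 shows χ(x) S = S. If S were apart from 0 it could be cancelled,
  -- making χ trivial; tightness then gives S = 0.
  ∑χ≈0 : ∀ χ → ¬ (χ ≋ ε) → 𝔽.∑ (χ ⟨_⟩) ≈ 0#
  ∑χ≈0 χ χ≉ε = ¬#0⇒≈0 λ S#0 → χ≉ε λ x → trivial S#0 x (x F.≟ F.0#)
    where
    S : K.Carrier
    S = 𝔽.∑ (χ ⟨_⟩)
    trivial : S K.# 0# → ∀ x → Dec (x F.≈ F.0#) → χ ⟨ x ⟩ ≈ ε ⟨ x ⟩
    trivial S#0 x (yes x≈0) = K.trans (eval-≈0 χ x≈0) (K.sym (ε-≈0 x≈0))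
    trivial S#0 x (no x≉0)  = K.trans (#0⇒*-cancelʳ S#0 (begin
      χ ⟨ x ⟩ * S                     ≈⟨ 𝔽.*-distribˡ-∑ _ (χ ⟨_⟩) ⟩
      𝔽.∑ (λ u → χ ⟨ x ⟩ * χ ⟨ u ⟩)   ≈⟨ 𝔽.∑-cong (λ u → eval-* χ x u) ⟨
      𝔽.∑ (λ u → χ ⟨ x F.* u ⟩)       ≈⟨ 𝔽.∑-reindex (eval-cong χ) (dilation F x≉0) ⟨
      S                               ≈⟨ K.*-identityˡ S ⟨
      1# * S                          ∎)) (K.sym (ε-≉0 x≉0))

  ∑ε : 𝔽.∑ (ε ⟨_⟩) ≈ (q ∸ 1) K.· 1#
  ∑ε = 𝔽.∑-cosupport (eval-cong ε) F.0# (ε-≈0 F.refl) (λ _ → ε-≉0)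

  evaluations : F.Carrier → K.Carrier
  evaluations t = Ĝ∑.∑ (_⟨ t ⟩)

  evaluations-cong : ∀ {t u} → t F.≈ u → evaluations t ≈ evaluations u
  evaluations-cong t≈u = Ĝ∑.∑-cong (λ χ → eval-cong χ t≈u)

  -- The dual argument: translating the summation by χ gives χ(t) S = S, and a separating χ excludes
  -- that S is apart from 0. At t = 0 each term vanishes.
  evaluations-≉1 : ∀ {t} → ¬ (t F.≈ F.1#) → evaluations t ≈ 0#
  evaluations-≉1 {t} t≉1 = helper (t F.≟ F.0#)
    where
    S : K.Carrier
    S = evaluations t
    helper : Dec (t F.≈ F.0#) → S ≈ 0#
    helper (yes t≈0) = Ĝ∑.∑-zero (λ χ → eval-≈0 χ t≈0)
    helper (no t≉0)  = ¬#0⇒≈0 λ S#0 → separate t≉0 t≉1 λ { (χ , χt≉1) →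
      χt≉1 (#0⇒*-cancelʳ S#0 (begin
        χ ⟨ t ⟩ * S                      ≈⟨ Ĝ∑.*-distribˡ-∑ _ (_⟨ t ⟩) ⟩
        Ĝ∑.∑ (λ ψ → (χ ∙ ψ) ⟨ t ⟩)       ≈⟨ Ĝ∑.∑-reindex (λ ψ≋φ → ψ≋φ t) (translation χ) ⟨
        S                                ≈⟨ K.*-identityˡ S ⟨
        1# * S                           ∎)) }

  -- Both sides are the sum of all values of all characters.
  evaluations-1 : evaluations F.1# ≈ (q ∸ 1) K.· 1#
  evaluations-1 = begin
    evaluations F.1#                       ≈⟨ 𝔽.∑-support evaluations-cong F.1# (λ _ → evaluations-≉1) ⟨
    𝔽.∑ (λ u → Ĝ∑.∑ (_⟨ u ⟩))              ≈⟨ ∑-swap K.semiring F.enumeration Ĝ-enumeration (λ u χ → χ ⟨ u ⟩) ⟩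
    Ĝ∑.∑ (λ χ → 𝔽.∑ (χ ⟨_⟩))               ≈⟨ Ĝ∑.∑-support (λ χ≋ψ → 𝔽.∑-cong χ≋ψ) ε ∑χ≈0 ⟩
    𝔽.∑ (ε ⟨_⟩)                            ≈⟨ ∑ε ⟩
    (q ∸ 1) K.· 1#                         ∎

  -- Jacobi sums and binomial coefficients

  ≈0-*ˡ : ∀ {a b} → a ≈ 0# → a * b ≈ 0#
  ≈0-*ˡ a≈0 = K.trans (K.*-congʳ a≈0) (K.zeroˡ _)

  ≈0-*ʳ : ∀ {a b} → b ≈ 0# → a * b ≈ 0#
  ≈0-*ʳ b≈0 = K.trans (K.*-congˡ b≈0) (K.zeroʳ _)

  eval-1-cong : ∀ χ {u v} → u F.≈ v → χ ⟨ F.1# F.- u ⟩ ≈ χ ⟨ F.1# F.- v ⟩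
  eval-1-cong χ u≈v = eval-cong χ (F.+-congˡ (F.-‿cong u≈v))

  eval-±1 : ∀ χ → χ ⟨ -1ᶠ ⟩ * χ ⟨ -1ᶠ ⟩ ≈ 1#
  eval-±1 χ = K.trans (K.sym (eval-* χ _ _)) (K.trans (eval-cong χ (-1*-1≈1 F)) (eval-1 χ))

  ⁻¹-eval-±1 : ∀ χ → (χ ⁻¹) ⟨ -1ᶠ ⟩ ≈ χ ⟨ -1ᶠ ⟩
  ⁻¹-eval-±1 χ = eval-cong χ (inv-unique F (x*y≈1⇒x≉0 F (-1*-1≈1 F)) (-1*-1≈1 F))

  jacobi≈∑ : ∀ A B → jacobi A B ≈ 𝔽.∑ (λ u → A ⟨ u ⟩ * B ⟨ F.1# F.- u ⟩)
  jacobi≈∑ A B = 𝔽.sum≈∑ (λ u → A ⟨ u ⟩ * B ⟨ F.1# F.- u ⟩)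

  jacobi-cong : ∀ C A B → A ≋ B → jacobi C A ≈ jacobi C B
  jacobi-cong C A B A≋B = K.trans (jacobi≈∑ C A)
    (K.trans (𝔽.∑-cong (λ u → K.*-congˡ (A≋B _))) (K.sym (jacobi≈∑ C B)))

  jacobi-comm : ∀ A B → jacobi A B ≈ jacobi B A
  jacobi-comm A B = begin
    jacobi A B
      ≈⟨ jacobi≈∑ A B ⟩
    𝔽.∑ (λ u → A ⟨ u ⟩ * B ⟨ F.1# F.- u ⟩)
      ≈⟨ 𝔽.∑-reindex (λ u≈v → K.*-cong (eval-cong A u≈v) (eval-1-cong B u≈v)) (reflection F) ⟩
    𝔽.∑ (λ u → A ⟨ F.1# F.- u ⟩ * B ⟨ F.1# F.- (F.1# F.- u) ⟩)
      ≈⟨ 𝔽.∑-cong (λ u → K.trans (K.*-comm _ _) (K.*-congʳ (eval-cong B (1-[1-x]≈x F u)))) ⟩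
    𝔽.∑ (λ u → B ⟨ u ⟩ * A ⟨ F.1# F.- u ⟩)
      ≈⟨ jacobi≈∑ B A ⟨
    jacobi B A
      ∎

  -- Substitute u ↦ 1/u in J(B⁻¹, A) and use 1 - 1/u = -(1/u)(1 - u). With `inv` sending 0 to 0 the
  -- substitution permutes the whole field, and the term at u = 0 vanishes on both sides.
  jacobi-⁻¹ : ∀ A B → jacobi A (B ⁻¹) ≈ A ⟨ -1ᶠ ⟩ * jacobi A (A ⁻¹ ∙ B)
  jacobi-⁻¹ A B = begin
    jacobi A (B ⁻¹)
      ≈⟨ jacobi-comm A (B ⁻¹) ⟩
    jacobi (B ⁻¹) A
      ≈⟨ jacobi≈∑ (B ⁻¹) A ⟩
    𝔽.∑ (λ u → B ⟨ F.inv u ⟩ * A ⟨ F.1# F.- u ⟩)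
      ≈⟨ 𝔽.∑-reindex (λ u≈v → K.*-cong (eval-cong (B ⁻¹) u≈v) (eval-1-cong A u≈v)) (inversion F) ⟩
    𝔽.∑ (λ u → B ⟨ F.inv (F.inv u) ⟩ * A ⟨ F.1# F.- F.inv u ⟩)
      ≈⟨ 𝔽.∑-cong (λ u → term u (u F.≟ F.0#)) ⟩
    𝔽.∑ (λ u → A ⟨ -1ᶠ ⟩ * ((A ⁻¹ ∙ B) ⟨ u ⟩ * A ⟨ F.1# F.- u ⟩))
      ≈⟨ 𝔽.*-distribˡ-∑ _ _ ⟨
    A ⟨ -1ᶠ ⟩ * 𝔽.∑ (λ u → (A ⁻¹ ∙ B) ⟨ u ⟩ * A ⟨ F.1# F.- u ⟩)
      ≈⟨ K.*-congˡ (jacobi≈∑ (A ⁻¹ ∙ B) A) ⟨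
    A ⟨ -1ᶠ ⟩ * jacobi (A ⁻¹ ∙ B) A
      ≈⟨ K.*-congˡ (jacobi-comm (A ⁻¹ ∙ B) A) ⟩
    A ⟨ -1ᶠ ⟩ * jacobi A (A ⁻¹ ∙ B)
      ∎
    where
    term : ∀ u → Dec (u F.≈ F.0#) → B ⟨ F.inv (F.inv u) ⟩ * A ⟨ F.1# F.- F.inv u ⟩ ≈
      A ⟨ -1ᶠ ⟩ * ((A ⁻¹ ∙ B) ⟨ u ⟩ * A ⟨ F.1# F.- u ⟩)
    term u (yes u≈0) = K.trans
      (≈0-*ˡ (eval-≈0 B (F.trans (inv-involutive F u) u≈0)))
      (K.sym (≈0-*ʳ (≈0-*ˡ (≈0-*ʳ (eval-≈0 B u≈0)))))
    term u (no u≉0) = begin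
      B ⟨ F.inv (F.inv u) ⟩ * A ⟨ F.1# F.- F.inv u ⟩
        ≈⟨ K.*-cong (eval-cong B (inv-involutive F u))
             (K.trans (eval-cong A (1-inv F u≉0)) (K.trans (eval-* A _ _) (K.*-congˡ (eval-* A _ _)))) ⟩
      B ⟨ u ⟩ * (A ⟨ -1ᶠ ⟩ * (A ⟨ F.inv u ⟩ * A ⟨ F.1# F.- u ⟩))
        ≈⟨ solve 4 (λ b m i w → b ⊕ (m ⊕ (i ⊕ w)) ⊜ m ⊕ ((i ⊕ b) ⊕ w)) K.refl _ _ _ _ ⟩
      A ⟨ -1ᶠ ⟩ * ((A ⁻¹ ∙ B) ⟨ u ⟩ * A ⟨ F.1# F.- u ⟩)
        ∎

  ⁻¹-cancel : ∀ A B → (A ⁻¹ ∙ (A ∙ B)) ≋ B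
  ⁻¹-cancel A B x = K.trans (K.sym (K.*-assoc _ _ _))
    (K.trans (K.*-congʳ (Ĝ.inverseˡ A x)) (Ĝ.identityˡ B x))

  binomial-cong : ∀ A B C → B ≋ C → binomial A B ≈ binomial A C
  binomial-cong A B C B≋C = K.*-cong (B≋C _) (jacobi-cong A (B ⁻¹) (C ⁻¹) (B≋C ∘ F.inv))

  -- After `jacobi-⁻¹` the sign A(-1) occurs twice and cancels.
  binomial-∙ : ∀ A B → binomial A (A ∙ B) ≈ B ⟨ -1ᶠ ⟩ * jacobi A B
  binomial-∙ A B = begin
    a * b * jacobi A ((A ∙ B) ⁻¹)                 ≈⟨ K.*-congˡ (jacobi-⁻¹ A (A ∙ B)) ⟩
    a * b * (a * jacobi A (A ⁻¹ ∙ (A ∙ B)))       ≈⟨ K.*-congˡ (K.*-congˡ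
      (jacobi-cong A (A ⁻¹ ∙ (A ∙ B)) B (⁻¹-cancel A B))) ⟩
    a * b * (a * jacobi A B)                      ≈⟨ solve 3
      (λ a b j → (a ⊕ b) ⊕ (a ⊕ j) ⊜ (a ⊕ a) ⊕ (b ⊕ j)) K.refl _ _ _ ⟩
    a * a * (b * jacobi A B)                      ≈⟨ K.*-congʳ (eval-±1 A) ⟩
    1# * (b * jacobi A B)                         ≈⟨ K.*-identityˡ _ ⟩
    b * jacobi A B                                ∎
    where
    a b : K.Carrier
    a = A ⟨ -1ᶠ ⟩
    b = B ⟨ -1ᶠ ⟩

  ∑∑-elements≈ : ∀ (f : F.Carrier → F.Carrier → K.Carrier) →
    ∑-elements (λ u → ∑-elements (f u)) ≈ 𝔽.∑ (λ u → 𝔽.∑ (f u))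
  ∑∑-elements≈ f = K.trans (𝔽.sum≈∑ (λ u → ∑-elements (f u))) (𝔽.∑-cong (λ u → 𝔽.sum≈∑ (f u)))

  -- Greene's binomial theorem

  N : K.Carrier
  N = (q ∸ 1) K.· 1#

  -- With the sum over χ taken first, orthogonality keeps only the s with `ratio F t s` equal to 1.
  -- That is s = 1/(1 - t), which contributes A(s) N. At t = 0 the formula fails: the left side is 0
  -- and the right side is N.
  binomial-theorem : ∀ A {t} → ¬ (t F.≈ F.0#) →
    Ĝ∑.∑ (λ χ → binomial (A ∙ χ) χ * χ ⟨ t ⟩) ≈ N * (A ⁻¹) ⟨ F.1# F.- t ⟩
  binomial-theorem A {t} t≉0 = begin
    Ĝ∑.∑ (λ χ → binomial (A ∙ χ) χ * χ ⟨ t ⟩)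
      ≈⟨ Ĝ∑.∑-cong expand ⟩
    Ĝ∑.∑ (λ χ → 𝔽.∑ (λ s → A ⟨ s ⟩ * χ ⟨ ratio F t s ⟩))
      ≈⟨ ∑-swap K.semiring Ĝ-enumeration F.enumeration (λ χ s → A ⟨ s ⟩ * χ ⟨ ratio F t s ⟩) ⟩
    𝔽.∑ (λ s → Ĝ∑.∑ (λ χ → A ⟨ s ⟩ * χ ⟨ ratio F t s ⟩))
      ≈⟨ 𝔽.∑-cong (λ s → Ĝ∑.*-distribˡ-∑ (A ⟨ s ⟩) (_⟨ ratio F t s ⟩)) ⟨
    𝔽.∑ f
      ≈⟨ collapse (F.1# F.- t F.≟ F.0#) ⟩
    N * (A ⁻¹) ⟨ F.1# F.- t ⟩
      ∎
    where
    f : F.Carrier → K.Carrier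
    f s = A ⟨ s ⟩ * evaluations (ratio F t s)

    f-cong : ∀ {r s} → r F.≈ s → f r ≈ f s
    f-cong r≈s = K.*-cong (eval-cong A r≈s) (evaluations-cong (ratio-cong F t r≈s))

    expand : ∀ χ → binomial (A ∙ χ) χ * χ ⟨ t ⟩ ≈ 𝔽.∑ (λ s → A ⟨ s ⟩ * χ ⟨ ratio F t s ⟩)
    expand χ = begin
      χ ⟨ -1ᶠ ⟩ * jacobi (A ∙ χ) (χ ⁻¹) * χ ⟨ t ⟩
        ≈⟨ solve 3 (λ m j c → (m ⊕ j) ⊕ c ⊜ (m ⊕ c) ⊕ j) K.refl _ _ _ ⟩
      χ ⟨ -1ᶠ ⟩ * χ ⟨ t ⟩ * jacobi (A ∙ χ) (χ ⁻¹)
        ≈⟨ K.*-congˡ (jacobi≈∑ (A ∙ χ) (χ ⁻¹)) ⟩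
      χ ⟨ -1ᶠ ⟩ * χ ⟨ t ⟩ * 𝔽.∑ (λ s → A ⟨ s ⟩ * χ ⟨ s ⟩ * χ ⟨ F.inv (F.1# F.- s) ⟩)
        ≈⟨ 𝔽.*-distribˡ-∑ _ _ ⟩
      𝔽.∑ (λ s → χ ⟨ -1ᶠ ⟩ * χ ⟨ t ⟩ * (A ⟨ s ⟩ * χ ⟨ s ⟩ * χ ⟨ F.inv (F.1# F.- s) ⟩))
        ≈⟨ 𝔽.∑-cong (λ s → solve 5 (λ m c a x y → (m ⊕ c) ⊕ ((a ⊕ x) ⊕ y) ⊜ a ⊕ ((m ⊕ (x ⊕ c)) ⊕ y))
             K.refl _ _ _ _ _) ⟩
      𝔽.∑ (λ s → A ⟨ s ⟩ * (χ ⟨ -1ᶠ ⟩ * (χ ⟨ s ⟩ * χ ⟨ t ⟩) * χ ⟨ F.inv (F.1# F.- s) ⟩))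
        ≈⟨ 𝔽.∑-cong (λ s → K.*-congˡ (K.trans (eval-* χ _ _)
             (K.*-congʳ (K.trans (eval-* χ _ _) (K.*-congˡ (eval-* χ _ _)))))) ⟨
      𝔽.∑ (λ s → A ⟨ s ⟩ * χ ⟨ ratio F t s ⟩)
        ∎

    collapse : Dec (F.1# F.- t F.≈ F.0#) → 𝔽.∑ f ≈ N * (A ⁻¹) ⟨ F.1# F.- t ⟩
    -- For t = 1 no s survives, in accordance with A⁻¹(0) = 0.
    collapse (yes w≈0) = K.trans
      (𝔽.∑-zero (λ s → ≈0-*ʳ (evaluations-≉1 (λ r≈1 →
        F.1≉0 (F.trans (F.sym (ratio≈1⇒ F r≈1)) (F.trans (F.*-congˡ w≈0) (F.zeroʳ s)))))))
      (K.sym (≈0-*ʳ (eval-≈0 (A ⁻¹) w≈0)))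
    collapse (no w≉0) = begin
      𝔽.∑ f                          ≈⟨ 𝔽.∑-support f-cong s₀ vanish ⟩
      A ⟨ s₀ ⟩ * evaluations (ratio F t s₀)
        ≈⟨ K.*-congˡ (K.trans (evaluations-cong
             (ratio≈1⇐ F t≉0 (inv-inverseˡ F w≉0))) evaluations-1) ⟩
      A ⟨ s₀ ⟩ * N                   ≈⟨ K.*-comm _ N ⟩
      N * A ⟨ s₀ ⟩                   ∎
      where
      s₀ : F.Carrier
      s₀ = F.inv (F.1# F.- t)
      vanish : ∀ s → ¬ (s F.≈ s₀) → f s ≈ 0#
      vanish s s≉s₀ = ≈0-*ʳ (evaluations-≉1 (λ r≈1 →
        s≉s₀ (F.sym (inv-unique F w≉0 (F.trans (F.*-comm _ s) (ratio≈1⇒ F r≈1))))))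

  -- Symmetry of `F₂` and its reduction to `₃F₂`

  module _ (A B B′ C C′ : Character) where

    F₂-symmetric : ∀ x y → F₂ A B B′ C C′ x y ≈ F₂ A B′ B C′ C y x
    F₂-symmetric x y = K.*-cong
      (K.*-cong (eval-cong ε (F.*-comm x y)) (swap₄ _ _ _ _))
      (begin
        ∑-elements (λ u → ∑-elements (f u))      ≈⟨ ∑∑-elements≈ f ⟩
        𝔽.∑ (λ u → 𝔽.∑ (f u))                    ≈⟨ ∑-swap K.semiring F.enumeration F.enumeration f ⟩
        𝔽.∑ (λ v → 𝔽.∑ (λ u → f u v))            ≈⟨ 𝔽.∑-cong (λ v → 𝔽.∑-cong (λ u → K.*-cong
          (swap₄ _ _ _ _) (eval-cong (A ⁻¹) (xy∙z≈xz∙y F.1# _ _)))) ⟩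
        𝔽.∑ (λ v → 𝔽.∑ (g v))                    ≈⟨ ∑∑-elements≈ g ⟨
        ∑-elements (λ v → ∑-elements (g v))      ∎)
      where
      open CommutativeSemigroupProperties F.+-commutativeSemigroup using (xy∙z≈xz∙y)
      f g : F.Carrier → F.Carrier → K.Carrier
      f u v = B ⟨ u ⟩ * B′ ⟨ v ⟩ * (B ⁻¹ ∙ C) ⟨ F.1# F.- u ⟩ * (B′ ⁻¹ ∙ C′) ⟨ F.1# F.- v ⟩
        * (A ⁻¹) ⟨ F.1# F.- u F.* x F.- v F.* y ⟩
      g v u = B′ ⟨ v ⟩ * B ⟨ u ⟩ * (B′ ⁻¹ ∙ C′) ⟨ F.1# F.- v ⟩ * (B ⁻¹ ∙ C) ⟨ F.1# F.- u ⟩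
        * (A ⁻¹) ⟨ F.1# F.- v F.* y F.- u F.* x ⟩
      swap₄ : ∀ b b′ c c′ → b * b′ * c * c′ ≈ b′ * b * c′ * c
      swap₄ = solve 4 (λ b b′ c c′ → ((b ⊕ b′) ⊕ c) ⊕ c′ ⊜ ((b′ ⊕ b) ⊕ c′) ⊕ c) K.refl

    module _ (x : F.Carrier) where

      private
        summand : F.Carrier → F.Carrier → K.Carrier
        summand u v = B ⟨ u ⟩ * B′ ⟨ v ⟩ * (B ⁻¹ ∙ C) ⟨ F.1# F.- u ⟩ * (B′ ⁻¹ ∙ C′) ⟨ F.1# F.- v ⟩
          * (A ⁻¹) ⟨ F.1# F.- u F.* x F.- v F.* F.1# ⟩

        D : Character → Character
        D χ = A ∙ C′ ⁻¹ ∙ χ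

        -- The factors depending on u and on v once the last factor of `summand` is expanded. Their
        -- sums over the field are J(Bχ, B⁻¹C) and J(B′, (B′D)⁻¹), where D stands for `D χ`.
        α β : Character → F.Carrier → K.Carrier
        α χ u = (B ∙ χ) ⟨ u ⟩ * (B ⁻¹ ∙ C) ⟨ F.1# F.- u ⟩
        β χ v = B′ ⟨ v ⟩ * ((B′ ∙ D χ) ⁻¹) ⟨ F.1# F.- v ⟩

        γ δ : Character → K.Carrier
        γ χ = binomial (A ∙ χ) χ
        δ χ = γ χ * binomial (B ∙ χ) (C ∙ χ) * binomial (A ∙ C′ ⁻¹ ∙ χ) (A ∙ B′ ∙ C′ ⁻¹ ∙ χ) * χ ⟨ x ⟩

      module _ (x≉0 : ¬ (x F.≈ F.0#)) where

        -- The binomial theorem needs 1 - v invertible and t = ux/(1 - v) nonzero. In the excluded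
        -- cases u = 0 and v = 1 both sides vanish, since characters are 0 at 0.
        summand-expansion : ∀ u v → summand u v * N ≈ Ĝ∑.∑ (λ χ → γ χ * α χ u * β χ v * χ ⟨ x ⟩)
        summand-expansion u v = helper (u F.≟ F.0#) (F.1# F.- v F.≟ F.0#)
          where
          helper : Dec (u F.≈ F.0#) → Dec (F.1# F.- v F.≈ F.0#) →
            summand u v * N ≈ Ĝ∑.∑ (λ χ → γ χ * α χ u * β χ v * χ ⟨ x ⟩)
          helper (yes u≈0) _ = K.trans
            (≈0-*ˡ (≈0-*ˡ (≈0-*ˡ (≈0-*ˡ (≈0-*ˡ (eval-≈0 B u≈0))))))
            (K.sym (Ĝ∑.∑-zero (λ χ → ≈0-*ˡ (≈0-*ˡ (≈0-*ʳ (≈0-*ˡ (eval-≈0 (B ∙ χ) u≈0)))))))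
          helper (no _) (yes w≈0) = K.trans
            (≈0-*ˡ (≈0-*ˡ (≈0-*ʳ (eval-≈0 (B′ ⁻¹ ∙ C′) w≈0))))
            (K.sym (Ĝ∑.∑-zero (λ χ → ≈0-*ˡ (≈0-*ʳ (≈0-*ʳ (eval-≈0 ((B′ ∙ D χ) ⁻¹) w≈0))))))
          helper (no u≉0) (no w≉0) = begin
            k * (A ⁻¹) ⟨ F.1# F.- u F.* x F.- v F.* F.1# ⟩ * N
              ≈⟨ K.*-congʳ (K.*-congˡ (K.trans (eval-cong (A ⁻¹) argument) (eval-* (A ⁻¹) w _))) ⟩
            k * ((A ⁻¹) ⟨ w ⟩ * (A ⁻¹) ⟨ F.1# F.- t ⟩) * N
              ≈⟨ solve 4 (λ k a c n → (k ⊕ (a ⊕ c)) ⊕ n ⊜ (k ⊕ a) ⊕ (n ⊕ c)) K.refl _ _ _ _ ⟩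
            k * (A ⁻¹) ⟨ w ⟩ * (N * (A ⁻¹) ⟨ F.1# F.- t ⟩)
              ≈⟨ K.*-congˡ (binomial-theorem A t≉0) ⟨
            k * (A ⁻¹) ⟨ w ⟩ * Ĝ∑.∑ (λ χ → γ χ * χ ⟨ t ⟩)
              ≈⟨ Ĝ∑.*-distribˡ-∑ _ _ ⟩
            Ĝ∑.∑ (λ χ → k * (A ⁻¹) ⟨ w ⟩ * (γ χ * χ ⟨ t ⟩))
              ≈⟨ Ĝ∑.∑-cong term ⟩
            Ĝ∑.∑ (λ χ → γ χ * α χ u * β χ v * χ ⟨ x ⟩)
              ∎
            where
            w t : F.Carrier
            w = F.1# F.- v
            t = u F.* x F.* F.inv w
            k : K.Carrier
            k = B ⟨ u ⟩ * B′ ⟨ v ⟩ * (B ⁻¹ ∙ C) ⟨ F.1# F.- u ⟩ * (B′ ⁻¹ ∙ C′) ⟨ w ⟩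
            argument : F.1# F.- u F.* x F.- v F.* F.1# F.≈ w F.* (F.1# F.- t)
            argument = F.trans (F.+-congˡ (F.-‿cong (F.*-identityʳ v)))
              (1-a-b≈[1-b][1-a/[1-b]] F (u F.* x) v w≉0)
            t≉0 : ¬ (t F.≈ F.0#)
            t≉0 = *-≉0 F (*-≉0 F u≉0 x≉0)
              (x*y≈1⇒x≉0 F (inv-inverseˡ F w≉0))
            term : ∀ χ → k * (A ⁻¹) ⟨ w ⟩ * (γ χ * χ ⟨ t ⟩) ≈ γ χ * α χ u * β χ v * χ ⟨ x ⟩
            term χ = begin
              k * (A ⁻¹) ⟨ w ⟩ * (γ χ * χ ⟨ t ⟩)
                ≈⟨ K.*-congˡ (K.*-congˡ (K.trans (eval-* χ _ _) (K.*-congʳ (eval-* χ u x)))) ⟩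
              k * (A ⁻¹) ⟨ w ⟩ * (γ χ * (χ ⟨ u ⟩ * χ ⟨ x ⟩ * χ ⟨ F.inv w ⟩))
                ≈⟨ solve 10 (λ b b′ p b″ c a g cu cx cw →
                     ((((b ⊕ b′) ⊕ p) ⊕ (b″ ⊕ c)) ⊕ a) ⊕ (g ⊕ ((cu ⊕ cx) ⊕ cw)) ⊜
                     ((g ⊕ ((b ⊕ cu) ⊕ p)) ⊕ (b′ ⊕ (b″ ⊕ ((a ⊕ c) ⊕ cw)))) ⊕ cx)
                     K.refl (B ⟨ u ⟩) (B′ ⟨ v ⟩) ((B ⁻¹ ∙ C) ⟨ F.1# F.- u ⟩) (B′ ⟨ F.inv w ⟩) (C′ ⟨ w ⟩)
                       (A ⟨ F.inv w ⟩) (γ χ) (χ ⟨ u ⟩) (χ ⟨ x ⟩) (χ ⟨ F.inv w ⟩) ⟩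
              γ χ * α χ u * (B′ ⟨ v ⟩ * (B′ ⟨ F.inv w ⟩ * (A ⟨ F.inv w ⟩ * C′ ⟨ w ⟩ * χ ⟨ F.inv w ⟩))) * χ ⟨ x ⟩
                -- In `β` the character C′ appears as the inverse of `C′ ⁻¹`, evaluated at
                -- `inv (inv w)`.
                ≈⟨ K.*-congʳ (K.*-congˡ (K.*-congˡ (K.*-congˡ (K.*-congʳ (K.*-congˡ
                     (eval-cong C′ (inv-involutive F w))))))) ⟨
              γ χ * α χ u * β χ v * χ ⟨ x ⟩
                ∎

        double-sum : 𝔽.∑ (λ u → 𝔽.∑ (summand u)) * N ≈
          Ĝ∑.∑ (λ χ → γ χ * jacobi (B ∙ χ) (B ⁻¹ ∙ C) * jacobi B′ ((B′ ∙ D χ) ⁻¹) * χ ⟨ x ⟩)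
        double-sum = begin
          𝔽.∑ (λ u → 𝔽.∑ (summand u)) * N
            ≈⟨ 𝔽.*-distribʳ-∑ N _ ⟩
          𝔽.∑ (λ u → 𝔽.∑ (summand u) * N)
            ≈⟨ 𝔽.∑-cong (λ u → K.trans (𝔽.*-distribʳ-∑ N _) (𝔽.∑-cong (summand-expansion u))) ⟩
          𝔽.∑ (λ u → 𝔽.∑ (λ v → Ĝ∑.∑ (λ χ → γ χ * α χ u * β χ v * χ ⟨ x ⟩)))
            ≈⟨ 𝔽.∑-cong (λ u → ∑-swap K.semiring F.enumeration Ĝ-enumeration
                 (λ v χ → γ χ * α χ u * β χ v * χ ⟨ x ⟩)) ⟩
          𝔽.∑ (λ u → Ĝ∑.∑ (λ χ → 𝔽.∑ (λ v → γ χ * α χ u * β χ v * χ ⟨ x ⟩)))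
            ≈⟨ ∑-swap K.semiring F.enumeration Ĝ-enumeration
                 (λ u χ → 𝔽.∑ (λ v → γ χ * α χ u * β χ v * χ ⟨ x ⟩)) ⟩
          Ĝ∑.∑ (λ χ → 𝔽.∑ (λ u → 𝔽.∑ (λ v → γ χ * α χ u * β χ v * χ ⟨ x ⟩)))
            ≈⟨ Ĝ∑.∑-cong factor ⟩
          Ĝ∑.∑ (λ χ → γ χ * 𝔽.∑ (α χ) * 𝔽.∑ (β χ) * χ ⟨ x ⟩)
            ≈⟨ Ĝ∑.∑-cong (λ χ → K.*-congʳ (K.*-cong (K.*-congˡ (jacobi≈∑ (B ∙ χ) (B ⁻¹ ∙ C)))
                 (jacobi≈∑ B′ ((B′ ∙ D χ) ⁻¹)))) ⟨
          Ĝ∑.∑ (λ χ → γ χ * jacobi (B ∙ χ) (B ⁻¹ ∙ C) * jacobi B′ ((B′ ∙ D χ) ⁻¹) * χ ⟨ x ⟩)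
            ∎
          where
          factor : ∀ χ → 𝔽.∑ (λ u → 𝔽.∑ (λ v → γ χ * α χ u * β χ v * χ ⟨ x ⟩)) ≈
            γ χ * 𝔽.∑ (α χ) * 𝔽.∑ (β χ) * χ ⟨ x ⟩
          factor χ = begin
            𝔽.∑ (λ u → 𝔽.∑ (λ v → γ χ * α χ u * β χ v * χ ⟨ x ⟩))
              ≈⟨ 𝔽.∑-cong (λ u → 𝔽.*-distribʳ-∑ _ _) ⟨
            𝔽.∑ (λ u → 𝔽.∑ (λ v → γ χ * α χ u * β χ v) * χ ⟨ x ⟩)
              ≈⟨ 𝔽.*-distribʳ-∑ _ _ ⟨
            𝔽.∑ (λ u → 𝔽.∑ (λ v → γ χ * α χ u * β χ v)) * χ ⟨ x ⟩
              ≈⟨ K.*-congʳ (𝔽.∑-cong (λ u → 𝔽.*-distribˡ-∑ _ _)) ⟨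
            𝔽.∑ (λ u → γ χ * α χ u * 𝔽.∑ (β χ)) * χ ⟨ x ⟩
              ≈⟨ K.*-congʳ (𝔽.*-distribʳ-∑ _ _) ⟨
            𝔽.∑ (λ u → γ χ * α χ u) * 𝔽.∑ (β χ) * χ ⟨ x ⟩
              ≈⟨ K.*-congʳ (K.*-congʳ (𝔽.*-distribˡ-∑ _ _)) ⟨
            γ χ * 𝔽.∑ (α χ) * 𝔽.∑ (β χ) * χ ⟨ x ⟩
              ∎

        -- Since Cχ = (Bχ)(B⁻¹C), this is `binomial-∙` with the sign (B⁻¹C)(-1) = BC(-1) moved
        -- across.
        jacobi-first : ∀ χ → jacobi (B ∙ χ) (B ⁻¹ ∙ C) ≈ (B ∙ C) ⟨ -1ᶠ ⟩ * binomial (B ∙ χ) (C ∙ χ)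
        jacobi-first χ = K.sym (begin
          bc * binomial (B ∙ χ) (C ∙ χ)                    ≈⟨ K.*-congˡ
            (binomial-cong (B ∙ χ) (C ∙ χ) (B ∙ χ ∙ (B ⁻¹ ∙ C)) Cχ≋) ⟩
          bc * binomial (B ∙ χ) (B ∙ χ ∙ (B ⁻¹ ∙ C))       ≈⟨ K.*-congˡ (binomial-∙ (B ∙ χ) (B ⁻¹ ∙ C)) ⟩
          bc * ((B ⁻¹) ⟨ -1ᶠ ⟩ * C ⟨ -1ᶠ ⟩ * j)            ≈⟨ K.*-congˡ (K.*-congʳ (K.*-congʳ (⁻¹-eval-±1 B))) ⟩
          bc * (bc * j)                                    ≈⟨ K.*-assoc _ _ _ ⟨
          bc * bc * j                                      ≈⟨ K.*-congʳ (eval-±1 (B ∙ C)) ⟩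
          1# * j                                           ≈⟨ K.*-identityˡ j ⟩
          j                                                ∎)
          where
          bc j : K.Carrier
          bc = (B ∙ C) ⟨ -1ᶠ ⟩
          j = jacobi (B ∙ χ) (B ⁻¹ ∙ C)
          Cχ≋ : (C ∙ χ) ≋ (B ∙ χ ∙ (B ⁻¹ ∙ C))
          Cχ≋ z = begin
            C ⟨ z ⟩ * χ ⟨ z ⟩
              ≈⟨ ⁻¹-cancel B (C ∙ χ) z ⟨
            (B ⁻¹) ⟨ z ⟩ * (B ⟨ z ⟩ * (C ⟨ z ⟩ * χ ⟨ z ⟩))
              ≈⟨ solve 4 (λ i b c x → i ⊕ (b ⊕ (c ⊕ x)) ⊜ (b ⊕ x) ⊕ (i ⊕ c)) K.refl _ _ _ _ ⟩
            B ⟨ z ⟩ * χ ⟨ z ⟩ * ((B ⁻¹) ⟨ z ⟩ * C ⟨ z ⟩)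
              ∎

        -- No sign remains: `jacobi-⁻¹` produces B′(-1) J(B′, D) with D = `D χ`, and after
        -- exchanging the arguments `binomial-∙` absorbs exactly this B′(-1).
        jacobi-second : ∀ χ → jacobi B′ ((B′ ∙ D χ) ⁻¹) ≈
          binomial (A ∙ C′ ⁻¹ ∙ χ) (A ∙ B′ ∙ C′ ⁻¹ ∙ χ)
        jacobi-second χ = begin
          jacobi B′ ((B′ ∙ D χ) ⁻¹)                         ≈⟨ jacobi-⁻¹ B′ (B′ ∙ D χ) ⟩
          B′ ⟨ -1ᶠ ⟩ * jacobi B′ (B′ ⁻¹ ∙ (B′ ∙ D χ))       ≈⟨ K.*-congˡ
            (jacobi-cong B′ (B′ ⁻¹ ∙ (B′ ∙ D χ)) (D χ) (⁻¹-cancel B′ (D χ))) ⟩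
          B′ ⟨ -1ᶠ ⟩ * jacobi B′ (D χ)                      ≈⟨ K.*-congˡ (jacobi-comm B′ (D χ)) ⟩
          B′ ⟨ -1ᶠ ⟩ * jacobi (D χ) B′                      ≈⟨ binomial-∙ (D χ) B′ ⟨
          binomial (D χ) (D χ ∙ B′)                         ≈⟨ binomial-cong (D χ) (D χ ∙ B′) (A ∙ B′ ∙ C′ ⁻¹ ∙ χ) (λ z →
            solve 4 (λ a b c x → ((a ⊕ c) ⊕ x) ⊕ b ⊜ ((a ⊕ b) ⊕ c) ⊕ x) K.refl
              (A ⟨ z ⟩) (B′ ⟨ z ⟩) ((C′ ⁻¹) ⟨ z ⟩) (χ ⟨ z ⟩)) ⟩
          binomial (D χ) (A ∙ B′ ∙ C′ ⁻¹ ∙ χ)               ∎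

        F₂-at-1-≉0 : F₂ A B B′ C C′ x F.1# ≈
          (B′ ∙ C′) ⟨ -1ᶠ ⟩ * ₃F₂ A B (A ∙ C′ ⁻¹) C (A ∙ B′ ∙ C′ ⁻¹) x
        F₂-at-1-≉0 = begin
          ε ⟨ x F.* F.1# ⟩ * (b * b′ * c * c′) * ∑-elements (λ u → ∑-elements (summand u))
            ≈⟨ K.*-cong (K.trans (K.*-congʳ (ε-≉0 (x≉0 ∘ F.trans (F.sym (F.*-identityʳ x)))))
                 (K.*-identityˡ _)) (K.trans (∑∑-elements≈ summand) X≈) ⟩
          b * b′ * c * c′ * (Q * (b * c * S))
            -- The sign BC(-1) of `F₂` meets the one from `jacobi-first`; their product is 1, which
            -- leaves B′C′(-1).
            ≈⟨ solve 6 (λ b b′ c c′ q s → (((b ⊕ b′) ⊕ c) ⊕ c′) ⊕ (q ⊕ ((b ⊕ c) ⊕ s)) ⊜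
                 ((b ⊕ c) ⊕ (b ⊕ c)) ⊕ ((b′ ⊕ c′) ⊕ (q ⊕ s))) K.refl b b′ c c′ Q S ⟩
          b * c * (b * c) * (b′ * c′ * (Q * S))
            ≈⟨ K.trans (K.*-congʳ (eval-±1 (B ∙ C))) (K.*-identityˡ _) ⟩
          b′ * c′ * (Q * S)
            ≈⟨ K.*-congˡ (K.*-congˡ (∑-characters≈ δ)) ⟨
          b′ * c′ * (Q * ∑-characters δ)
            ∎
          where
          b b′ c c′ Q X S : K.Carrier
          b  = B ⟨ -1ᶠ ⟩
          b′ = B′ ⟨ -1ᶠ ⟩
          c  = C ⟨ -1ᶠ ⟩
          c′ = C′ ⟨ -1ᶠ ⟩
          Q  = K.1/ (q ∸ 1)
          X  = 𝔽.∑ (λ u → 𝔽.∑ (summand u))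
          S  = Ĝ∑.∑ δ
          term : ∀ χ → γ χ * jacobi (B ∙ χ) (B ⁻¹ ∙ C) * jacobi B′ ((B′ ∙ D χ) ⁻¹) * χ ⟨ x ⟩ ≈ b * c * δ χ
          term χ = K.trans (K.*-congʳ (K.*-cong (K.*-congˡ (jacobi-first χ)) (jacobi-second χ)))
            (solve 5 (λ g m j k z → ((g ⊕ (m ⊕ j)) ⊕ k) ⊕ z ⊜ m ⊕ (((g ⊕ j) ⊕ k) ⊕ z)) K.refl
              (γ χ) (b * c) (binomial (B ∙ χ) (C ∙ χ)) (binomial (D χ) (A ∙ B′ ∙ C′ ⁻¹ ∙ χ)) (χ ⟨ x ⟩))
          X≈ : X ≈ Q * (b * c * S)
          X≈ = begin
            X                                    ≈⟨ K.*-identityʳ X ⟨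
            X * 1#                               ≈⟨ K.*-congˡ (K.1/-inverse (q ∸ 1)) ⟨
            X * (N * Q)                          ≈⟨ K.*-assoc X N Q ⟨
            X * N * Q                            ≈⟨ K.*-comm _ Q ⟩
            Q * (X * N)                          ≈⟨ K.*-congˡ double-sum ⟩
            Q * Ĝ∑.∑ _                           ≈⟨ K.*-congˡ (Ĝ∑.∑-cong term) ⟩
            Q * Ĝ∑.∑ (λ χ → b * c * δ χ)         ≈⟨ K.*-congˡ (Ĝ∑.*-distribˡ-∑ (b * c) δ) ⟨
            Q * (b * c * S)                      ∎

      F₂-at-1 : F₂ A B B′ C C′ x F.1# ≈
        (B′ ∙ C′) ⟨ -1ᶠ ⟩ * ₃F₂ A B (A ∙ C′ ⁻¹) C (A ∙ B′ ∙ C′ ⁻¹) x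
      F₂-at-1 with x F.≟ F.0#
      ... | no x≉0  = F₂-at-1-≉0 x≉0
      -- At x = 0 the factor ε(xy) of `F₂` vanishes, and so does every χ(0) in `₃F₂`, the trivial
      -- character included.
      ... | yes x≈0 = K.trans
        (≈0-*ˡ (≈0-*ˡ (ε-≈0 (F.trans (F.*-identityʳ x) x≈0))))
        (K.sym (≈0-*ʳ (≈0-*ʳ (K.trans (∑-characters≈ δ)
          (Ĝ∑.∑-zero (λ χ → ≈0-*ʳ (eval-≈0 χ x≈0)))))))

open import Data.Nat.Base using (_^_)

proposition1p1 : ∀ {c₁ ℓ₁ c₂ ℓ₂ ℓ₃} (p r : ℕ) → Prime p →
    (F : FiniteField (p ^ r) c₁ ℓ₁) (K : AlgClosedField₀ c₂ ℓ₂ ℓ₃) →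
    let open Characters F K in
    let open AlgClosedField₀ K hiding (1#) in
    let open FiniteField F using (1#) renaming (Carrier to 𝔽) in
    (A B B′ C C′ : Character) (x y : 𝔽) →
    (F₂ A B B′ C C′ x y ≈ F₂ A B′ B C′ C y x) ×
    (F₂ A B B′ C C′ x 1# ≈ (B′ ∙ C′) ⟨ -1ᶠ ⟩ * ₃F₂ A B (A ∙ C′ ⁻¹) C (A ∙ B′ ∙ C′ ⁻¹) x) ×
    (F₂ A B B′ C C′ 1# y ≈ (B ∙ C) ⟨ -1ᶠ ⟩ * ₃F₂ A B′ (A ∙ C ⁻¹) C′ (A ∙ B ∙ C ⁻¹) y)
proposition1p1 p r _ F K A B B′ C C′ x y =
  F₂-symmetric F K A B B′ C C′ x y ,
  F₂-at-1 F K A B B′ C C′ x ,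
  -- Symmetry moves the argument 1 to the second place, with the primed and unprimed characters
  -- exchanged.
  trans (F₂-symmetric F K A B B′ C C′ (FiniteField.1# F) y) (F₂-at-1 F K A B′ B C′ C y)
  where open AlgClosedField₀ K using (trans)
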